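{- Let $\mathcal{C}$ be a category with pushouts and pullbacks, equipped with a costable factorisation system $(\mathcal{E},\mathcal{M})$ such that every morphism of $\mathcal{M}$ is a monomorphism. Let $\mathcal{A}$ be a subcategory of $\mathcal{C}$ containing $\mathcal{M}$, stable under pullback, and such that for every cospan $X\xrightarrow{f}A\xleftarrow{g}Y$ in $\mathcal{A}$, the unique induced morphism from the pushout (in $\mathcal{C}$) of the pullback span (in $\mathcal{C}$) of $f,g$ to $A$ lies in $\mathcal{M}$. Then the square \[ \begin{array}{ccc} \mathcal{A}+_{|\mathcal{A}|}\mathcal{A}^{op} & \longrightarrow & \mathrm{Span}(\mathcal{A})\\ \downarrow & & \downarrow \Pi\\ \mathrm{Cospan}(\mathcal{C}) & \xrightarrow{\ \Gamma\ } & \mathrm{Corel}(\mathcal{C}) \end{array} \] is a pushout in the category $\mathbf{CAT}$ of categories and functors.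
   Context: Composition is written diagrammatically ($f;g$ means first $f$, then $g$). A factorisation system $(\mathcal{E},\mathcal{M})$: subcategories containing all isomorphisms such that every morphism factors as $e;m$ with $e\in\mathcal{E}$, $m\in\mathcal{M}$, with the unique diagonal fill-in property (given $f=e;m$, $f'=e';m'$ and $u,v$ with $f;v=u;f'$, there is a unique $s$ with $e;s=u;e'$, $m;v=s;m'$). Costable: $\mathcal{M}$ stable under pushout (in a pushout square, if a morphism out of the apex is in $\mathcal{M}$, so is the opposite side). $\mathcal{A}$ stable under pullback: in a pullback square, if a morphism into the corner lies in $\mathcal{A}$, so does the opposite side. $\mathrm{Cospan}(\mathcal{C})$ (resp. $\mathrm{Span}(\mathcal{C})$): objects of $\mathcal{C}$, morphisms isomorphism classes of cospans (resp. spans), composed by pushout (resp. pullback); $\mathrm{Span}(\mathcal{A})$ is the subcategory of spans with both legs in $\mathcal{A}$. $\mathrm{Corel}(\mathcal{C})$: objects of $\mathcal{C}$, morphisms $X\to Y$ equivalence classes of cospans $X\xrightarrow{f}N\xleftarrow{g}Y$ under the equivalence relation generated by relating it to $X\xrightarrow{f'}N'\xleftarrow{g'}Y$ whenever some $m\colon N\to N'$ in $\mathcal{M}$ has $f;m=f'$, $g;m=g'$; composition by pushout. $\Gamma$ is the identity-on-objects functor sending a cospan to the corelation it represents. $\Pi$ is the identity-on-objects functor sending a span in $\mathcal{A}$ to the corelation represented by its pushout cospan in $\mathcal{C}$. $\mathcal{A}+_{|\mathcal{A}|}\mathcal{A}^{op}$ is the category with the objects of $\mathcal{A}$ whose morphisms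 are finite zigzags $X\xrightarrow{f}\cdot\xleftarrow{g}\cdot\xrightarrow{h}\cdots Y$ of non-identity morphisms of $\mathcal{A}$ (alternating direction), composed by concatenation, composing consecutive same-direction arrows in $\mathcal{A}$ and removing resulting identities, with the empty zigzag as identity (equivalently the pushout of $\mathcal{A}$ and $\mathcal{A}^{op}$ over the discrete category on the objects). The functor to $\mathrm{Span}(\mathcal{A})$ sends a forward arrow $f$ to the span $(\mathrm{id},f)$ and a backward arrow $g$ to $(g,\mathrm{id})$, extended by composition; the functor to $\mathrm{Cospan}(\mathcal{C})$ sends $f$ forward to the cospan $(f,\mathrm{id})$ and $g$ backward to $(\mathrm{id},g)$, extended by composition. -}

module Defs where

open import Level using (Level; _⊔_; suc)
open import Data.Product using (Σ-syntax; _×_; _,_; proj₁; proj₂)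
open import Relation.Binary.Bundles using (Setoid)
open import Relation.Binary.Structures using (IsEquivalence)
open import Relation.Binary.PropositionalEquality using (_≡_; refl; sym; trans; cong; cong₂; subst₂; isEquivalence)
open import Relation.Binary.PropositionalEquality.Properties
  using (trans-reflʳ; trans-assoc)
open import Relation.Binary.Construct.Closure.ReflexiveTransitive
  using (Star; ε; _◅_; _◅◅_)
open import Relation.Binary.Construct.Closure.ReflexiveTransitive.Properties
  using (◅◅-assoc)
import Relation.Binary.Construct.Closure.Equivalence as Eq
open Eq using (EqClosure)
import Relation.Binary.Reasoning.Setoid as SetoidReasoning

private
  variable
    o ℓ e o₁ ℓ₁ e₁ o₂ ℓ₂ e₂ o₃ ℓ₃ e₃ κ κ′ : Level

-- Categories and functors.  Hom-types carry an equivalence relation _≈_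
-- (so that a quotient of a hom-set is a change of _≈_); objects are
-- compared by _≡_.  Composition is written in diagrammatic order.

record Category (o ℓ e : Level) : Set (suc (o ⊔ ℓ ⊔ e)) where
  infix  4 _⇒_ _≈_
  infixr 9 _⨾_
  field
    Obj       : Set o
    _⇒_       : Obj → Obj → Set ℓ
    _≈_       : ∀ {X Y} → X ⇒ Y → X ⇒ Y → Set e
    id        : ∀ {X} → X ⇒ X
    _⨾_       : ∀ {X Y Z} → X ⇒ Y → Y ⇒ Z → X ⇒ Z
    equiv     : ∀ {X Y} → IsEquivalence (_≈_ {X} {Y})
    ⨾-cong    : ∀ {X Y Z} {f f′ : X ⇒ Y} {g g′ : Y ⇒ Z} →
                f ≈ f′ → g ≈ g′ → f ⨾ g ≈ f′ ⨾ g′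
    identityˡ : ∀ {X Y} {f : X ⇒ Y} → id ⨾ f ≈ f
    identityʳ : ∀ {X Y} {f : X ⇒ Y} → f ⨾ id ≈ f
    assoc     : ∀ {W X Y Z} {f : W ⇒ X} {g : X ⇒ Y} {h : Y ⇒ Z} →
                (f ⨾ g) ⨾ h ≈ f ⨾ (g ⨾ h)

  module ≈ {X Y} = IsEquivalence (equiv {X} {Y})

  homSetoid : Obj → Obj → Setoid ℓ e
  homSetoid X Y = record { Carrier = X ⇒ Y ; _≈_ = _≈_ ; isEquivalence = equiv }

  record Iso {X Y : Obj} (f : X ⇒ Y) : Set (ℓ ⊔ e) where
    field
      inv  : Y ⇒ X
      isoˡ : f ⨾ inv ≈ id
      isoʳ : inv ⨾ f ≈ id

  Mono : ∀ {X Y} → X ⇒ Y → Set (o ⊔ ℓ ⊔ e)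
  Mono {X} m = ∀ {W} (u v : W ⇒ X) → u ⨾ m ≈ v ⨾ m → u ≈ v

op : Category o ℓ e → Category o ℓ e
op C = record
  { Obj = Obj ; _⇒_ = λ X Y → Y ⇒ X ; _≈_ = _≈_ ; id = id ; _⨾_ = λ f g → g ⨾ f
  ; equiv = equiv ; ⨾-cong = λ p q → ⨾-cong q p
  ; identityˡ = identityʳ ; identityʳ = identityˡ ; assoc = ≈.sym assoc }
  where open Category C

record IsFunctor (A : Category o₁ ℓ₁ e₁) (B : Category o₂ ℓ₂ e₂)
                 (F₀ : Category.Obj A → Category.Obj B)
                 (F₁ : ∀ {X Y} → Category._⇒_ A X Y → Category._⇒_ B (F₀ X) (F₀ Y))
                 : Set (o₁ ⊔ ℓ₁ ⊔ e₁ ⊔ e₂) where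
  private
    module A = Category A
    module B = Category B
  field
    F-cong : ∀ {X Y} {f g : X A.⇒ Y} → f A.≈ g → F₁ f B.≈ F₁ g
    F-id   : ∀ {X} → F₁ (A.id {X}) B.≈ B.id
    F-⨾    : ∀ {X Y Z} (f : X A.⇒ Y) (g : Y A.⇒ Z) → F₁ (f A.⨾ g) B.≈ F₁ f B.⨾ F₁ g

record Functor (A : Category o₁ ℓ₁ e₁) (B : Category o₂ ℓ₂ e₂)
               : Set (o₁ ⊔ ℓ₁ ⊔ e₁ ⊔ o₂ ⊔ ℓ₂ ⊔ e₂) where
  private
    module A = Category A
    module B = Category B
  field
    F₀        : A.Obj → B.Obj
    F₁        : ∀ {X Y} → X A.⇒ Y → F₀ X B.⇒ F₀ Y
    isFunctor : IsFunctor A B F₀ F₁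
  open IsFunctor isFunctor public

infixr 9 _⨾F_
_⨾F_ : {A : Category o₁ ℓ₁ e₁} {B : Category o₂ ℓ₂ e₂} {D : Category o₃ ℓ₃ e₃} →
       Functor A B → Functor B D → Functor A D
_⨾F_ {D = D} F G = record
  { F₀ = λ X → G.F₀ (F.F₀ X)
  ; F₁ = λ f → G.F₁ (F.F₁ f)
  ; isFunctor = record
    { F-cong = λ p → G.F-cong (F.F-cong p)
    ; F-id   = D.≈.trans (G.F-cong F.F-id) G.F-id
    ; F-⨾    = λ f g → D.≈.trans (G.F-cong (F.F-⨾ f g)) (G.F-⨾ (F.F₁ f) (F.F₁ g)) } }
  where
    module F = Functor F
    module G = Functor G
    module D = Category D

-- Equality of functors as morphisms of CAT: strict equality on objects,
-- and equality on morphisms after transport along it.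
infix 4 _≡F_
record _≡F_ {A : Category o₁ ℓ₁ e₁} {B : Category o₂ ℓ₂ e₂} (F G : Functor A B)
            : Set (o₁ ⊔ ℓ₁ ⊔ o₂ ⊔ e₂) where
  private
    module A = Category A
    module B = Category B
    module F = Functor F
    module G = Functor G
  field
    eq₀ : ∀ X → F.F₀ X ≡ G.F₀ X
    eq₁ : ∀ {X Y} (f : X A.⇒ Y) →
          subst₂ B._⇒_ (eq₀ X) (eq₀ Y) (F.F₁ f) B.≈ G.F₁ f

-- The square  F ⨾ H = G ⨾ K  is a pushout in CAT, tested against
-- categories in the universe (o₃ , ℓ₃ , e₃).
record IsPushoutInCAT {oa ℓa ea ob ℓb eb oc ℓc ec od ℓd ed : Level}
  {A : Category oa ℓa ea} {B : Category ob ℓb eb}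
  {C : Category oc ℓc ec} {D : Category od ℓd ed}
  (F : Functor A B) (G : Functor A C) (H : Functor B D) (K : Functor C D)
  (o₃ ℓ₃ e₃ : Level)
  : Set (oa ⊔ ℓa ⊔ ea ⊔ ob ⊔ ℓb ⊔ eb ⊔ oc ⊔ ℓc ⊔ ec ⊔ od ⊔ ℓd ⊔ ed ⊔ suc (o₃ ⊔ ℓ₃ ⊔ e₃)) where
  field
    commute   : F ⨾F H ≡F G ⨾F K
    universal : (X : Category o₃ ℓ₃ e₃) (P : Functor B X) (Q : Functor C X) →
                F ⨾F P ≡F G ⨾F Q →
                Σ[ U ∈ Functor D X ]
                  (H ⨾F U ≡F P) × (K ⨾F U ≡F Q) ×
                  (∀ (V : Functor D X) → H ⨾F V ≡F P → K ⨾F V ≡F Q → V ≡F U)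

module _ (C : Category o ℓ e) where
  open Category C

  record IsPushout {S X Y Q : Obj} (f : S ⇒ X) (g : S ⇒ Y) (i : X ⇒ Q) (j : Y ⇒ Q)
                   : Set (o ⊔ ℓ ⊔ e) where
    field
      commute     : f ⨾ i ≈ g ⨾ j
      universal   : ∀ {Z} {h : X ⇒ Z} {k : Y ⇒ Z} → f ⨾ h ≈ g ⨾ k → Q ⇒ Z
      i-universal : ∀ {Z} {h : X ⇒ Z} {k : Y ⇒ Z} {eq : f ⨾ h ≈ g ⨾ k} →
                    i ⨾ universal eq ≈ h
      j-universal : ∀ {Z} {h : X ⇒ Z} {k : Y ⇒ Z} {eq : f ⨾ h ≈ g ⨾ k} →
                    j ⨾ universal eq ≈ k
      unique      : ∀ {Z} {u v : Q ⇒ Z} → i ⨾ u ≈ i ⨾ v → j ⨾ u ≈ j ⨾ v → u ≈ v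

  record IsPullback {P X Y A : Obj} (p : P ⇒ X) (q : P ⇒ Y) (f : X ⇒ A) (g : Y ⇒ A)
                    : Set (o ⊔ ℓ ⊔ e) where
    field
      commute     : p ⨾ f ≈ q ⨾ g
      universal   : ∀ {Z} {h : Z ⇒ X} {k : Z ⇒ Y} → h ⨾ f ≈ k ⨾ g → Z ⇒ P
      universal-p : ∀ {Z} {h : Z ⇒ X} {k : Z ⇒ Y} {eq : h ⨾ f ≈ k ⨾ g} →
                    universal eq ⨾ p ≈ h
      universal-q : ∀ {Z} {h : Z ⇒ X} {k : Z ⇒ Y} {eq : h ⨾ f ≈ k ⨾ g} →
                    universal eq ⨾ q ≈ k
      unique      : ∀ {Z} {u v : Z ⇒ P} → u ⨾ p ≈ v ⨾ p → u ⨾ q ≈ v ⨾ q → u ≈ v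

  record Pushout {S X Y : Obj} (f : S ⇒ X) (g : S ⇒ Y) : Set (o ⊔ ℓ ⊔ e) where
    field
      {Q}       : Obj
      i         : X ⇒ Q
      j         : Y ⇒ Q
      isPushout : IsPushout f g i j
    open IsPushout isPushout public

  record Pullback {X Y A : Obj} (f : X ⇒ A) (g : Y ⇒ A) : Set (o ⊔ ℓ ⊔ e) where
    field
      {P}        : Obj
      p          : P ⇒ X
      q          : P ⇒ Y
      isPullback : IsPullback p q f g
    open IsPullback isPullback public

  HasPushouts : Set (o ⊔ ℓ ⊔ e)
  HasPushouts = ∀ {S X Y} (f : S ⇒ X) (g : S ⇒ Y) → Pushout f g

  HasPullbacks : Set (o ⊔ ℓ ⊔ e)
  HasPullbacks = ∀ {X Y A} (f : X ⇒ A) (g : Y ⇒ A) → Pullback f g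

-- A subcategory containing all objects, as a class of morphisms.  A
-- subcategory containing all isomorphisms (or containing another such
-- subcategory) contains all identities, so it is automatically of this
-- form.
record WideSubcategory (C : Category o ℓ e) (κ : Level) : Set (o ⊔ ℓ ⊔ e ⊔ suc κ) where
  open Category C
  field
    mem      : ∀ {X Y} → X ⇒ Y → Set κ
    mem-cong : ∀ {X Y} {f g : X ⇒ Y} → f ≈ g → mem f → mem g
    mem-id   : ∀ {X} → mem (id {X})
    mem-⨾    : ∀ {X Y Z} {f : X ⇒ Y} {g : Y ⇒ Z} → mem f → mem g → mem (f ⨾ g)

  category : Category o (ℓ ⊔ κ) e
  category = record
    { Obj = Obj
    ; _⇒_ = λ X Y → Σ[ f ∈ X ⇒ Y ] mem f
    ; _≈_ = λ f g → proj₁ f ≈ proj₁ g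
    ; id = id , mem-id
    ; _⨾_ = λ f g → proj₁ f ⨾ proj₁ g , mem-⨾ (proj₂ f) (proj₂ g)
    ; equiv = record { refl = ≈.refl ; sym = ≈.sym ; trans = ≈.trans }
    ; ⨾-cong = ⨾-cong
    ; identityˡ = identityˡ ; identityʳ = identityʳ ; assoc = assoc }

module _ {C : Category o ℓ e} where
  open Category C

  ContainsIsos : WideSubcategory C κ → Set (o ⊔ ℓ ⊔ e ⊔ κ)
  ContainsIsos A = ∀ {X Y} (f : X ⇒ Y) → Iso f → WideSubcategory.mem A f

  infix 4 _⊆_
  _⊆_ : WideSubcategory C κ → WideSubcategory C κ′ → Set (o ⊔ ℓ ⊔ κ ⊔ κ′)
  A ⊆ B = ∀ {X Y} (f : X ⇒ Y) → WideSubcategory.mem A f → WideSubcategory.mem B f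

  PushoutStable : WideSubcategory C κ → Set (o ⊔ ℓ ⊔ e ⊔ κ)
  PushoutStable A = ∀ {S X Y Q} {f : S ⇒ X} {g : S ⇒ Y} {i : X ⇒ Q} {j : Y ⇒ Q} →
    IsPushout C f g i j → WideSubcategory.mem A f → WideSubcategory.mem A j

  PullbackStable : WideSubcategory C κ → Set (o ⊔ ℓ ⊔ e ⊔ κ)
  PullbackStable A = ∀ {P X Y Z} {p : P ⇒ X} {q : P ⇒ Y} {f : X ⇒ Z} {g : Y ⇒ Z} →
    IsPullback C p q f g → WideSubcategory.mem A f → WideSubcategory.mem A q

  AllMono : WideSubcategory C κ → Set (o ⊔ ℓ ⊔ e ⊔ κ)
  AllMono A = ∀ {X Y} (f : X ⇒ Y) → WideSubcategory.mem A f → Mono f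

  module _ (pushouts : HasPushouts C) (pullbacks : HasPullbacks C) where

    -- The comparison morphism into A from the pushout of the pullback
    -- span of f and g.
    induced : ∀ {X Y A} (f : X ⇒ A) (g : Y ⇒ A) →
              Pushout.Q (pushouts (Pullback.p (pullbacks f g)) (Pullback.q (pullbacks f g))) ⇒ A
    induced f g = Pushout.universal (pushouts (Pullback.p pb) (Pullback.q pb)) (Pullback.commute pb)
      where pb = pullbacks f g

    InducedIn : WideSubcategory C κ → WideSubcategory C κ′ → Set (o ⊔ ℓ ⊔ κ ⊔ κ′)
    InducedIn A M = ∀ {X Y Z} (f : X ⇒ Z) (g : Y ⇒ Z) →
      WideSubcategory.mem A f → WideSubcategory.mem A g → WideSubcategory.mem M (induced f g)

record FactorisationSystem (C : Category o ℓ e) (ε μ : Level)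
                           : Set (o ⊔ ℓ ⊔ e ⊔ suc (ε ⊔ μ)) where
  open Category C
  field
    E : WideSubcategory C ε
    M : WideSubcategory C μ
  module E = WideSubcategory E
  module M = WideSubcategory M
  field
    iso∈E  : ContainsIsos E
    iso∈M  : ContainsIsos M
    factor : ∀ {X Y} (f : X ⇒ Y) →
             Σ[ I ∈ Obj ] Σ[ e ∈ X ⇒ I ] Σ[ m ∈ I ⇒ Y ] E.mem e × M.mem m × f ≈ e ⨾ m
    fill   : ∀ {X Y X′ Y′ I I′} {f : X ⇒ Y} {f′ : X′ ⇒ Y′}
             {e : X ⇒ I} {m : I ⇒ Y} {e′ : X′ ⇒ I′} {m′ : I′ ⇒ Y′} →
             E.mem e → M.mem m → E.mem e′ → M.mem m′ →
             f ≈ e ⨾ m → f′ ≈ e′ ⨾ m′ →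
             (u : X ⇒ X′) (v : Y ⇒ Y′) → f ⨾ v ≈ u ⨾ f′ →
             Σ[ s ∈ I ⇒ I′ ] (e ⨾ s ≈ u ⨾ e′ × m ⨾ v ≈ s ⨾ m′) ×
               (∀ (t : I ⇒ I′) → e ⨾ t ≈ u ⨾ e′ → m ⨾ v ≈ t ⨾ m′ → t ≈ s)

module CatLemmas (C : Category o ℓ e) where
  open Category C

  open module HomReasoning {X Y : Obj} = SetoidReasoning (homSetoid X Y) public
    using (begin_; step-≈-⟩; step-≈-⟨; _∎)

  lhs : ∀ {X Y Z} {f f′ : X ⇒ Y} {g : Y ⇒ Z} → f ≈ f′ → f ⨾ g ≈ f′ ⨾ g
  lhs p = ⨾-cong p ≈.refl

  rhs : ∀ {X Y Z} {f : X ⇒ Y} {g g′ : Y ⇒ Z} → g ≈ g′ → f ⨾ g ≈ f ⨾ g′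
  rhs p = ⨾-cong ≈.refl p

  pull : ∀ {W X Y Z} {f : W ⇒ X} {g : X ⇒ Y} {h : W ⇒ Y} {k : Y ⇒ Z} →
         f ⨾ g ≈ h → f ⨾ (g ⨾ k) ≈ h ⨾ k
  pull p = ≈.trans (≈.sym assoc) (lhs p)

  pull₂ : ∀ {W X Y Y′ Z} {f : W ⇒ X} {g : X ⇒ Y} {h : W ⇒ Y′} {h′ : Y′ ⇒ Y} {k : Y ⇒ Z} →
          f ⨾ g ≈ h ⨾ h′ → f ⨾ (g ⨾ k) ≈ h ⨾ (h′ ⨾ k)
  pull₂ p = ≈.trans (pull p) assoc

  push : ∀ {W X Y Z} {f : W ⇒ X} {g : X ⇒ Y} {k : Y ⇒ Z} {h : X ⇒ Z} →
         g ⨾ k ≈ h → (f ⨾ g) ⨾ k ≈ f ⨾ h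
  push p = ≈.trans assoc (rhs p)

  idComm : ∀ {X Y} {f : X ⇒ Y} → f ⨾ id ≈ id ⨾ f
  idComm = ≈.trans identityʳ (≈.sym identityˡ)

  iso-id : ∀ {X} → Iso (id {X})
  iso-id = record { inv = id ; isoˡ = identityˡ ; isoʳ = identityˡ }

  iso-⨾ : ∀ {X Y Z} {f : X ⇒ Y} {g : Y ⇒ Z} → Iso f → Iso g → Iso (f ⨾ g)
  iso-⨾ {f = f} {g} F G = record
    { inv = G.inv ⨾ F.inv
    ; isoˡ = ≈.trans assoc (≈.trans (rhs (≈.trans (pull G.isoˡ) identityˡ)) F.isoˡ)
    ; isoʳ = ≈.trans assoc (≈.trans (rhs (≈.trans (pull F.isoʳ) identityˡ)) G.isoʳ) }
    where
      module F = Iso F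
      module G = Iso G

  IsPushout-swap : ∀ {S X Y Q} {f : S ⇒ X} {g : S ⇒ Y} {i : X ⇒ Q} {j : Y ⇒ Q} →
                   IsPushout C f g i j → IsPushout C g f j i
  IsPushout-swap po = record
    { commute = ≈.sym commute
    ; universal = λ eq → universal (≈.sym eq)
    ; i-universal = j-universal ; j-universal = i-universal
    ; unique = λ p q → unique q p }
    where open IsPushout po

  IsPullback-swap : ∀ {P X Y Z} {p : P ⇒ X} {q : P ⇒ Y} {f : X ⇒ Z} {g : Y ⇒ Z} →
                    IsPullback C p q f g → IsPullback C q p g f
  IsPullback-swap pb = record
    { commute = ≈.sym commute
    ; universal = λ eq → universal (≈.sym eq)
    ; universal-p = universal-q ; universal-q = universal-p
    ; unique = λ p q → unique q p }
    where open IsPullback pb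

  -- The pushout of a composite g ⨾ m along h, as the pushout of m along
  -- the pushout of h along g.
  pasting : ∀ {S N N′ P Q Q′} {g : S ⇒ N} {h : S ⇒ P} {i : N ⇒ Q} {j : P ⇒ Q}
            {g′ : S ⇒ N′} {i′ : N′ ⇒ Q′} {j′ : P ⇒ Q′} {m : N ⇒ N′} {u : Q ⇒ Q′} →
            IsPushout C g h i j → IsPushout C g′ h i′ j′ →
            g ⨾ m ≈ g′ → i ⨾ u ≈ m ⨾ i′ → j ⨾ u ≈ j′ → IsPushout C m i i′ u
  pasting {g = g} {h} {i} {j} {g′} {i′} {j′} {m} {u} po po′ gm iu ju = record
    { commute = ≈.sym iu
    ; universal = λ eq → po′.universal (cone eq)
    ; i-universal = po′.i-universal
    ; j-universal = λ {_} {_} {_} {eq} → po.unique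
        (≈.trans (pull₂ iu) (≈.trans (rhs po′.i-universal) eq))
        (≈.trans (pull ju) po′.j-universal)
    ; unique = λ p q → po′.unique p
        (≈.trans (≈.sym (pull ju)) (≈.trans (rhs q) (pull ju))) }
    where
      module po  = IsPushout po
      module po′ = IsPushout po′
      cone : ∀ {Z} {a : _ ⇒ Z} {b : _ ⇒ Z} → m ⨾ a ≈ i ⨾ b → g′ ⨾ a ≈ h ⨾ (j ⨾ b)
      cone {a = a} {b} eq = begin
        g′ ⨾ a       ≈⟨ lhs gm ⟨
        (g ⨾ m) ⨾ a  ≈⟨ push eq ⟩
        g ⨾ (i ⨾ b)  ≈⟨ pull₂ po.commute ⟩
        h ⨾ (j ⨾ b)  ∎

  -- Composing the pushouts U of (a , b) and V of (c , d) over Y is the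
  -- pushout of the comparison h : K ⇒ Y along t, where K and L are the
  -- pushouts of (p , q) and (p ⨾ a , q ⨾ d).
  comparison :
    ∀ {W S T X Y Z K L U V R}
    {a : S ⇒ X} {b : S ⇒ Y} {c : T ⇒ Y} {d : T ⇒ Z} {p : W ⇒ S} {q : W ⇒ T}
    {k₁ : S ⇒ K} {k₂ : T ⇒ K} {l₁ : X ⇒ L} {l₂ : Z ⇒ L}
    {u₁ : X ⇒ U} {u₂ : Y ⇒ U} {v₁ : Y ⇒ V} {v₂ : Z ⇒ V} {r₁ : U ⇒ R} {r₂ : V ⇒ R}
    {h : K ⇒ Y} {t : K ⇒ L} {s : L ⇒ R} →
    IsPushout C p q k₁ k₂ → IsPushout C (p ⨾ a) (q ⨾ d) l₁ l₂ →
    IsPushout C a b u₁ u₂ → IsPushout C c d v₁ v₂ → IsPushout C u₂ v₁ r₁ r₂ →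
    k₁ ⨾ h ≈ b → k₂ ⨾ h ≈ c → k₁ ⨾ t ≈ a ⨾ l₁ → k₂ ⨾ t ≈ d ⨾ l₂ →
    l₁ ⨾ s ≈ u₁ ⨾ r₁ → l₂ ⨾ s ≈ v₂ ⨾ r₂ →
    IsPushout C h t (u₂ ⨾ r₁) s
  comparison {a = a} {b} {c} {d} {k₁ = k₁} {k₂} {l₁} {l₂} {u₁} {u₂} {v₁} {v₂} {r₁} {r₂} {h} {t} {s}
             poK poL poU poV poR k₁h k₂h k₁t k₂t l₁s l₂s = record
    { commute = K.unique
        (begin
          k₁ ⨾ h ⨾ u₂ ⨾ r₁  ≈⟨ pull k₁h ⟩
          b ⨾ u₂ ⨾ r₁       ≈⟨ pull₂ U.commute ⟨
          a ⨾ u₁ ⨾ r₁       ≈⟨ rhs l₁s ⟨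
          a ⨾ l₁ ⨾ s        ≈⟨ pull₂ k₁t ⟨
          k₁ ⨾ t ⨾ s        ∎)
        (begin
          k₂ ⨾ h ⨾ u₂ ⨾ r₁  ≈⟨ pull k₂h ⟩
          c ⨾ u₂ ⨾ r₁       ≈⟨ rhs R.commute ⟩
          c ⨾ v₁ ⨾ r₂       ≈⟨ pull₂ V.commute ⟩
          d ⨾ v₂ ⨾ r₂       ≈⟨ rhs l₂s ⟨
          d ⨾ l₂ ⨾ s        ≈⟨ pull₂ k₂t ⟨
          k₂ ⨾ t ⨾ s        ∎)
    ; universal = λ eq → fromR eq
    ; i-universal = λ {_} {_} {_} {eq} →
        ≈.trans assoc (≈.trans (rhs R.i-universal) U.j-universal)
    ; j-universal = λ {_} {y} {x} {eq} → L.unique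
        (begin
          l₁ ⨾ s ⨾ fromR eq   ≈⟨ pull₂ l₁s ⟩
          u₁ ⨾ r₁ ⨾ fromR eq  ≈⟨ rhs R.i-universal ⟩
          u₁ ⨾ fromU eq       ≈⟨ U.i-universal ⟩
          l₁ ⨾ x              ∎)
        (begin
          l₂ ⨾ s ⨾ fromR eq   ≈⟨ pull₂ l₂s ⟩
          v₂ ⨾ r₂ ⨾ fromR eq  ≈⟨ rhs R.j-universal ⟩
          v₂ ⨾ fromV eq       ≈⟨ V.j-universal ⟩
          l₂ ⨾ x              ∎)
    ; unique = λ {_} {w} {w′} eqY eqL → R.unique
        (U.unique
          (begin
            u₁ ⨾ r₁ ⨾ w    ≈⟨ pull₂ l₁s ⟨
            l₁ ⨾ s ⨾ w     ≈⟨ rhs eqL ⟩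
            l₁ ⨾ s ⨾ w′    ≈⟨ pull₂ l₁s ⟩
            u₁ ⨾ r₁ ⨾ w′   ∎)
          (≈.trans (≈.sym assoc) (≈.trans eqY assoc)))
        (V.unique
          (begin
            v₁ ⨾ r₂ ⨾ w    ≈⟨ pull (≈.sym R.commute) ⟩
            (u₂ ⨾ r₁) ⨾ w   ≈⟨ eqY ⟩
            (u₂ ⨾ r₁) ⨾ w′  ≈⟨ push ≈.refl ⟩
            u₂ ⨾ r₁ ⨾ w′   ≈⟨ pull₂ R.commute ⟩
            v₁ ⨾ r₂ ⨾ w′   ∎)
          (begin
            v₂ ⨾ r₂ ⨾ w    ≈⟨ pull₂ l₂s ⟨
            l₂ ⨾ s ⨾ w     ≈⟨ rhs eqL ⟩
            l₂ ⨾ s ⨾ w′    ≈⟨ pull₂ l₂s ⟩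
            v₂ ⨾ r₂ ⨾ w′   ∎)) }
    where
      module K = IsPushout poK
      module L = IsPushout poL
      module U = IsPushout poU
      module V = IsPushout poV
      module R = IsPushout poR
      fromU : ∀ {O} {y : _ ⇒ O} {x : _ ⇒ O} → h ⨾ y ≈ t ⨾ x → _ ⇒ O
      fromU {y = y} {x} eq = U.universal {h = l₁ ⨾ x} {k = y} (begin
        a ⨾ l₁ ⨾ x  ≈⟨ pull₂ k₁t ⟨
        k₁ ⨾ t ⨾ x  ≈⟨ rhs eq ⟨
        k₁ ⨾ h ⨾ y  ≈⟨ pull k₁h ⟩
        b ⨾ y       ∎)
      fromV : ∀ {O} {y : _ ⇒ O} {x : _ ⇒ O} → h ⨾ y ≈ t ⨾ x → _ ⇒ O
      fromV {y = y} {x} eq = V.universal {h = y} {k = l₂ ⨾ x} (begin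
        c ⨾ y       ≈⟨ pull k₂h ⟨
        k₂ ⨾ h ⨾ y  ≈⟨ rhs eq ⟩
        k₂ ⨾ t ⨾ x  ≈⟨ pull₂ k₂t ⟩
        d ⨾ l₂ ⨾ x  ∎)
      fromR : ∀ {O} {y : _ ⇒ O} {x : _ ⇒ O} → h ⨾ y ≈ t ⨾ x → _ ⇒ O
      fromR eq = R.universal {h = fromU eq} {k = fromV eq}
        (≈.trans U.j-universal (≈.sym V.i-universal))

module _ (C : Category o ℓ e) where
  open Category C

  record Cospan (X Y : Obj) : Set (o ⊔ ℓ) where
    constructor cospan
    field
      {apex} : Obj
      left   : X ⇒ apex
      right  : Y ⇒ apex

  record CospanIso {X Y : Obj} (c d : Cospan X Y) : Set (ℓ ⊔ e) where
    private
      module c = Cospan c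
      module d = Cospan d
    field
      φ       : c.apex ⇒ d.apex
      φ-iso   : Iso φ
      φ-left  : c.left ⨾ φ ≈ d.left
      φ-right : c.right ⨾ φ ≈ d.right

module CospanLemmas (C : Category o ℓ e) (pushouts : HasPushouts C) where
  open Category C
  open CatLemmas C
  open Cospan

  idCospan : ∀ {X} → Cospan C X X
  idCospan = cospan id id

  po : ∀ {X Y Z} (c : Cospan C X Y) (d : Cospan C Y Z) → Pushout C (right c) (left d)
  po c d = pushouts (right c) (left d)

  infixr 9 _⨾C_
  _⨾C_ : ∀ {X Y Z} → Cospan C X Y → Cospan C Y Z → Cospan C X Z
  c ⨾C d = cospan (left c ⨾ Pushout.i (po c d)) (right d ⨾ Pushout.j (po c d))

  refl-iso : ∀ {X Y} {c : Cospan C X Y} → CospanIso C c c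
  refl-iso = record { φ = id ; φ-iso = iso-id ; φ-left = identityʳ ; φ-right = identityʳ }

  sym-iso : ∀ {X Y} {c d : Cospan C X Y} → CospanIso C c d → CospanIso C d c
  sym-iso f = record
    { φ = inv
    ; φ-iso = record { inv = φ ; isoˡ = isoʳ ; isoʳ = isoˡ }
    ; φ-left = ≈.trans (lhs (≈.sym φ-left)) (≈.trans (push isoˡ) identityʳ)
    ; φ-right = ≈.trans (lhs (≈.sym φ-right)) (≈.trans (push isoˡ) identityʳ) }
    where
      open CospanIso f
      open Iso φ-iso

  trans-iso : ∀ {X Y} {b c d : Cospan C X Y} → CospanIso C b c → CospanIso C c d → CospanIso C b d
  trans-iso f g = record
    { φ = F.φ ⨾ G.φ
    ; φ-iso = iso-⨾ F.φ-iso G.φ-iso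
    ; φ-left = ≈.trans (pull F.φ-left) G.φ-left
    ; φ-right = ≈.trans (pull F.φ-right) G.φ-right }
    where
      module F = CospanIso f
      module G = CospanIso g

  module Comp {X Y Z} {c c′ : Cospan C X Y} {d d′ : Cospan C Y Z}
              {φ : apex c ⇒ apex c′} {ψ : apex d ⇒ apex d′}
              (φr : right c ⨾ φ ≈ right c′) (ψl : left d ⨾ ψ ≈ left d′) where
    private
      module P  = Pushout (po c d)
      module P′ = Pushout (po c′ d′)

    map : apex (c ⨾C d) ⇒ apex (c′ ⨾C d′)
    map = P.universal {h = φ ⨾ P′.i} {k = ψ ⨾ P′.j}
      (≈.trans (pull φr) (≈.trans P′.commute (≈.sym (pull ψl))))

    i-map : P.i ⨾ map ≈ φ ⨾ P′.i
    i-map = P.i-universal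

    j-map : P.j ⨾ map ≈ ψ ⨾ P′.j
    j-map = P.j-universal

    map-left : left c ⨾ φ ≈ left c′ → left (c ⨾C d) ⨾ map ≈ left (c′ ⨾C d′)
    map-left φl = ≈.trans (push i-map) (pull φl)

    map-right : right d ⨾ ψ ≈ right d′ → right (c ⨾C d) ⨾ map ≈ right (c′ ⨾C d′)
    map-right ψr = ≈.trans (push j-map) (pull ψr)

  cong-iso : ∀ {X Y Z} {c c′ : Cospan C X Y} {d d′ : Cospan C Y Z} →
             CospanIso C c c′ → CospanIso C d d′ → CospanIso C (c ⨾C d) (c′ ⨾C d′)
  cong-iso {c = c} {c′} {d} {d′} f g = record
    { φ = Fw.map
    ; φ-iso = record
      { inv = Bw.map
      ; isoˡ = Pushout.unique (po c d)
          (≈.trans (pull₂ Fw.i-map) (≈.trans (rhs Bw.i-map)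
            (≈.trans (pull (Iso.isoˡ F.φ-iso)) (≈.sym idComm))))
          (≈.trans (pull₂ Fw.j-map) (≈.trans (rhs Bw.j-map)
            (≈.trans (pull (Iso.isoˡ G.φ-iso)) (≈.sym idComm))))
      ; isoʳ = Pushout.unique (po c′ d′)
          (≈.trans (pull₂ Bw.i-map) (≈.trans (rhs Fw.i-map)
            (≈.trans (pull (Iso.isoʳ F.φ-iso)) (≈.sym idComm))))
          (≈.trans (pull₂ Bw.j-map) (≈.trans (rhs Fw.j-map)
            (≈.trans (pull (Iso.isoʳ G.φ-iso)) (≈.sym idComm)))) }
    ; φ-left = Fw.map-left F.φ-left
    ; φ-right = Fw.map-right G.φ-right }
    where
      module F = CospanIso f
      module G = CospanIso g
      module Fw = Comp {c = c} {c′} {d} {d′} F.φ-right G.φ-left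
      module Bw = Comp {c = c′} {c} {d′} {d}
        (CospanIso.φ-right (sym-iso f)) (CospanIso.φ-left (sym-iso g))

  identityˡ-iso : ∀ {X Y} {c : Cospan C X Y} → CospanIso C (idCospan ⨾C c) c
  identityˡ-iso {c = c} = record
    { φ = φ
    ; φ-iso = record
      { inv = P.j
      ; isoˡ = P.unique
          (≈.trans (pull P.i-universal) (≈.trans (≈.sym P.commute)
            (≈.trans identityˡ (≈.sym identityʳ))))
          (≈.trans (pull P.j-universal) (≈.sym idComm))
      ; isoʳ = P.j-universal }
    ; φ-left = ≈.trans (push P.i-universal) identityˡ
    ; φ-right = ≈.trans (push P.j-universal) identityʳ }
    where
      module P = Pushout (po idCospan c)
      φ : P.Q ⇒ apex c
      φ = P.universal {h = left c} {k = id} (≈.sym idComm)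

  identityʳ-iso : ∀ {X Y} {c : Cospan C X Y} → CospanIso C (c ⨾C idCospan) c
  identityʳ-iso {c = c} = record
    { φ = φ
    ; φ-iso = record
      { inv = P.i
      ; isoˡ = P.unique
          (≈.trans (pull P.i-universal) (≈.sym idComm))
          (≈.trans (pull P.j-universal) (≈.trans P.commute
            (≈.trans identityˡ (≈.sym identityʳ))))
      ; isoʳ = P.i-universal }
    ; φ-left = ≈.trans (push P.i-universal) identityʳ
    ; φ-right = ≈.trans (push P.j-universal) identityˡ }
    where
      module P = Pushout (po c idCospan)
      φ : P.Q ⇒ apex c
      φ = P.universal {h = id} {k = right c} idComm

  assoc-iso : ∀ {W X Y Z} {b : Cospan C W X} {c : Cospan C X Y} {d : Cospan C Y Z} →
              CospanIso C ((b ⨾C c) ⨾C d) (b ⨾C (c ⨾C d))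
  assoc-iso {b = b} {c} {d} = record
    { φ = φ
    ; φ-iso = record
      { inv = ψ
      ; isoˡ = L.unique
          (BC.unique
            (begin
              BC.i ⨾ L.i ⨾ φ ⨾ ψ  ≈⟨ rhs (pull L.i-universal) ⟩
              BC.i ⨾ φ₁ ⨾ ψ       ≈⟨ pull BC.i-universal ⟩
              R.i ⨾ ψ             ≈⟨ R.i-universal ⟩
              BC.i ⨾ L.i          ≈⟨ rhs identityʳ ⟨
              BC.i ⨾ L.i ⨾ id     ∎)
            (begin
              BC.j ⨾ L.i ⨾ φ ⨾ ψ  ≈⟨ rhs (pull L.i-universal) ⟩
              BC.j ⨾ φ₁ ⨾ ψ       ≈⟨ pull₂ BC.j-universal ⟩
              CD.i ⨾ R.j ⨾ ψ      ≈⟨ rhs R.j-universal ⟩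
              CD.i ⨾ ψ₁           ≈⟨ CD.i-universal ⟩
              BC.j ⨾ L.i          ≈⟨ rhs identityʳ ⟨
              BC.j ⨾ L.i ⨾ id     ∎))
          (begin
            L.j ⨾ φ ⨾ ψ     ≈⟨ pull₂ L.j-universal ⟩
            CD.j ⨾ R.j ⨾ ψ  ≈⟨ rhs R.j-universal ⟩
            CD.j ⨾ ψ₁       ≈⟨ CD.j-universal ⟩
            L.j             ≈⟨ identityʳ ⟨
            L.j ⨾ id        ∎)
      ; isoʳ = R.unique
          (begin
            R.i ⨾ ψ ⨾ φ     ≈⟨ pull₂ R.i-universal ⟩
            BC.i ⨾ L.i ⨾ φ  ≈⟨ rhs L.i-universal ⟩
            BC.i ⨾ φ₁       ≈⟨ BC.i-universal ⟩
            R.i             ≈⟨ identityʳ ⟨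
            R.i ⨾ id        ∎)
          (CD.unique
            (begin
              CD.i ⨾ R.j ⨾ ψ ⨾ φ  ≈⟨ rhs (pull R.j-universal) ⟩
              CD.i ⨾ ψ₁ ⨾ φ       ≈⟨ pull₂ CD.i-universal ⟩
              BC.j ⨾ L.i ⨾ φ      ≈⟨ rhs L.i-universal ⟩
              BC.j ⨾ φ₁           ≈⟨ BC.j-universal ⟩
              CD.i ⨾ R.j          ≈⟨ rhs identityʳ ⟨
              CD.i ⨾ R.j ⨾ id     ∎)
            (begin
              CD.j ⨾ R.j ⨾ ψ ⨾ φ  ≈⟨ rhs (pull R.j-universal) ⟩
              CD.j ⨾ ψ₁ ⨾ φ       ≈⟨ pull CD.j-universal ⟩
              L.j ⨾ φ             ≈⟨ L.j-universal ⟩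
              CD.j ⨾ R.j          ≈⟨ rhs identityʳ ⟨
              CD.j ⨾ R.j ⨾ id     ∎)) }
    ; φ-left = begin
        ((left b ⨾ BC.i) ⨾ L.i) ⨾ φ  ≈⟨ push L.i-universal ⟩
        (left b ⨾ BC.i) ⨾ φ₁         ≈⟨ push BC.i-universal ⟩
        left b ⨾ R.i                 ∎
    ; φ-right = begin
        (right d ⨾ L.j) ⨾ φ       ≈⟨ push L.j-universal ⟩
        right d ⨾ (CD.j ⨾ R.j)    ≈⟨ assoc ⟨
        (right d ⨾ CD.j) ⨾ R.j    ∎ }
    where
      module BC = Pushout (po b c)
      module CD = Pushout (po c d)
      module L  = Pushout (po (b ⨾C c) d)
      module R  = Pushout (po b (c ⨾C d))
      φ₁ : BC.Q ⇒ R.Q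
      φ₁ = BC.universal {h = R.i} {k = CD.i ⨾ R.j} (≈.trans R.commute assoc)
      φ : L.Q ⇒ R.Q
      φ = L.universal {h = φ₁} {k = CD.j ⨾ R.j} (begin
        (right c ⨾ BC.j) ⨾ φ₁      ≈⟨ push BC.j-universal ⟩
        right c ⨾ CD.i ⨾ R.j       ≈⟨ pull₂ CD.commute ⟩
        left d ⨾ CD.j ⨾ R.j        ∎)
      ψ₁ : CD.Q ⇒ L.Q
      ψ₁ = CD.universal {h = BC.j ⨾ L.i} {k = L.j} (≈.trans (≈.sym assoc) L.commute)
      ψ : R.Q ⇒ L.Q
      ψ = R.universal {h = BC.i ⨾ L.i} {k = ψ₁} (begin
        right b ⨾ BC.i ⨾ L.i       ≈⟨ pull₂ BC.commute ⟩
        left c ⨾ BC.j ⨾ L.i        ≈⟨ rhs CD.i-universal ⟨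
        left c ⨾ CD.i ⨾ ψ₁         ≈⟨ assoc ⟨
        (left c ⨾ CD.i) ⨾ ψ₁       ∎)

CospanCat : (C : Category o ℓ e) → HasPushouts C → Category o (o ⊔ ℓ) (ℓ ⊔ e)
CospanCat C pushouts = record
  { Obj = Category.Obj C
  ; _⇒_ = Cospan C
  ; _≈_ = CospanIso C
  ; id = idCospan
  ; _⨾_ = _⨾C_
  ; equiv = record { refl = refl-iso ; sym = sym-iso ; trans = trans-iso }
  ; ⨾-cong = cong-iso
  ; identityˡ = identityˡ-iso
  ; identityʳ = identityʳ-iso
  ; assoc = λ {_} {_} {_} {_} {b} {c} {d} → assoc-iso {b = b} {c} {d} }
  where open CospanLemmas C pushouts

module _ {C : Category o ℓ e} {ε μ : Level} (FS : FactorisationSystem C ε μ) where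
  open Category C
  open FactorisationSystem FS using (M; module M)

  record CorelStep {X Y : Obj} (c d : Cospan C X Y) : Set (ℓ ⊔ e ⊔ μ) where
    private
      module c = Cospan c
      module d = Cospan d
    field
      m       : c.apex ⇒ d.apex
      m∈M     : M.mem m
      m-left  : c.left ⨾ m ≈ d.left
      m-right : c.right ⨾ m ≈ d.right

  _∼_ : ∀ {X Y} → Cospan C X Y → Cospan C X Y → Set (o ⊔ ℓ ⊔ e ⊔ μ)
  _∼_ = EqClosure CorelStep

  module CorelLemmas (pushouts : HasPushouts C) (costable : PushoutStable M) where
    open CatLemmas C
    open CospanLemmas C pushouts

    iso⇒∼ : ∀ {X Y} {c d : Cospan C X Y} → CospanIso C c d → c ∼ d
    iso⇒∼ f = Eq.return record
      { m = φ ; m∈M = FactorisationSystem.iso∈M FS φ φ-iso ; m-left = φ-left ; m-right = φ-right }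
      where open CospanIso f

    stepˡ : ∀ {X Y Z} {c c′ : Cospan C X Y} (d : Cospan C Y Z) →
            CorelStep c c′ → CorelStep (c ⨾C d) (c′ ⨾C d)
    stepˡ {c = c} {c′} d s = record
      { m = K.map
      ; m∈M = costable
          (pasting (Pushout.isPushout (po c d)) (Pushout.isPushout (po c′ d))
                   m-right K.i-map (≈.trans K.j-map identityˡ))
          m∈M
      ; m-left = K.map-left m-left
      ; m-right = K.map-right identityʳ }
      where
        open CorelStep s
        module K = Comp {c = c} {c′} {d} {d} m-right identityʳ

    stepʳ : ∀ {X Y Z} (c : Cospan C X Y) {d d′ : Cospan C Y Z} →
            CorelStep d d′ → CorelStep (c ⨾C d) (c ⨾C d′)
    stepʳ c {d} {d′} s = record
      { m = K.map
      ; m∈M = costable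
          (pasting (IsPushout-swap (Pushout.isPushout (po c d)))
                   (IsPushout-swap (Pushout.isPushout (po c d′)))
                   m-left K.j-map (≈.trans K.i-map identityˡ))
          m∈M
      ; m-left = K.map-left identityʳ
      ; m-right = K.map-right m-right }
      where
        open CorelStep s
        module K = Comp {c = c} {c} {d} {d′} identityʳ m-left

    ∼-cong : ∀ {X Y Z} {c c′ : Cospan C X Y} {d d′ : Cospan C Y Z} →
             c ∼ c′ → d ∼ d′ → (c ⨾C d) ∼ (c′ ⨾C d′)
    ∼-cong {c′ = c′} {d} p q =
      Eq.gmap (_⨾C d) (stepˡ d) p ◅◅ Eq.gmap (c′ ⨾C_) (stepʳ c′) q

module _ {C : Category o ℓ e} (pushouts : HasPushouts C)
         {ε μ : Level} (FS : FactorisationSystem C ε μ)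
         (costable : PushoutStable (FactorisationSystem.M FS)) where
  open CospanLemmas C pushouts
  open CorelLemmas FS pushouts costable

  Corel : Category o (o ⊔ ℓ) (o ⊔ ℓ ⊔ e ⊔ μ)
  Corel = record
    { Obj = Category.Obj C
    ; _⇒_ = Cospan C
    ; _≈_ = _∼_ FS
    ; id = idCospan
    ; _⨾_ = _⨾C_
    ; equiv = Eq.isEquivalence (CorelStep FS)
    ; ⨾-cong = ∼-cong
    ; identityˡ = iso⇒∼ identityˡ-iso
    ; identityʳ = iso⇒∼ identityʳ-iso
    ; assoc = λ {_} {_} {_} {_} {b} {c} {d} → iso⇒∼ (assoc-iso {b = b} {c} {d}) }

  Γ : Functor (CospanCat C pushouts) Corel
  Γ = record
    { F₀ = λ X → X
    ; F₁ = λ c → c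
    ; isFunctor = record
      { F-cong = iso⇒∼
      ; F-id = Category.≈.refl Corel
      ; F-⨾ = λ c d → Category.≈.refl Corel {x = c ⨾C d} } }

module _ {C : Category o ℓ e} {α : Level} (A : WideSubcategory C α) where
  open Category C
  open WideSubcategory A

  record Span (X Y : Obj) : Set (o ⊔ ℓ ⊔ α) where
    constructor span
    field
      {apex}  : Obj
      {left}  : apex ⇒ X
      {right} : apex ⇒ Y
      left∈   : mem left
      right∈  : mem right

  record SpanIso {X Y : Obj} (s t : Span X Y) : Set (ℓ ⊔ e) where
    private
      module s = Span s
      module t = Span t
    field
      φ       : s.apex ⇒ t.apex
      φ-iso   : Iso φ
      φ-left  : φ ⨾ t.left ≈ s.left
      φ-right : φ ⨾ t.right ≈ s.right

  module SpanLemmas (pullbacks : HasPullbacks C) (stable : PullbackStable A) where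
    open CatLemmas C using (IsPullback-swap)

    pb : ∀ {X Y Z} (s : Span X Y) (t : Span Y Z) → Pullback C (Span.right s) (Span.left t)
    pb s t = pullbacks (Span.right s) (Span.left t)

    idSpan : ∀ {X} → Span X X
    idSpan = span mem-id mem-id

    infixr 9 _⨾S_
    _⨾S_ : ∀ {X Y Z} → Span X Y → Span Y Z → Span X Z
    s ⨾S t = span (mem-⨾ (stable (IsPullback-swap isPullback) (Span.left∈ t)) (Span.left∈ s))
                  (mem-⨾ (stable isPullback (Span.right∈ s)) (Span.right∈ t))
      where open Pullback (pb s t)

    -- Spans in C are cospans in op C; the category laws are transported
    -- along this correspondence.
    pushoutsᵒᵖ : HasPushouts (op C)
    pushoutsᵒᵖ f g = record
      { i = p ; j = q
      ; isPushout = record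
        { commute = commute ; universal = universal
        ; i-universal = universal-p ; j-universal = universal-q ; unique = unique } }
      where open Pullback (pullbacks f g)

    toCospan : ∀ {X Y} → Span X Y → Cospan (op C) X Y
    toCospan s = cospan (Span.left s) (Span.right s)

    toIso : ∀ {X Y} {s t : Span X Y} → SpanIso s t → CospanIso (op C) (toCospan t) (toCospan s)
    toIso f = record
      { φ = φ ; φ-iso = record { inv = inv ; isoˡ = isoʳ ; isoʳ = isoˡ }
      ; φ-left = φ-left ; φ-right = φ-right }
      where
        open SpanIso f
        open Iso φ-iso

    fromIso : ∀ {X Y} {s t : Span X Y} → CospanIso (op C) (toCospan t) (toCospan s) → SpanIso s t
    fromIso f = record
      { φ = φ ; φ-iso = record { inv = inv ; isoˡ = isoʳ ; isoʳ = isoˡ }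
      ; φ-left = φ-left ; φ-right = φ-right }
      where
        open CospanIso f
        open Category.Iso φ-iso

    module L = CospanLemmas (op C) pushoutsᵒᵖ

    SpanCat : Category o (o ⊔ ℓ ⊔ α) (ℓ ⊔ e)
    SpanCat = record
      { Obj = Obj
      ; _⇒_ = Span
      ; _≈_ = SpanIso
      ; id = idSpan
      ; _⨾_ = _⨾S_
      ; equiv = record
        { refl = fromIso L.refl-iso
        ; sym = λ f → fromIso (L.sym-iso (toIso f))
        ; trans = λ f g → fromIso (L.trans-iso (toIso g) (toIso f)) }
      ; ⨾-cong = λ f g → fromIso (L.cong-iso (toIso f) (toIso g))
      ; identityˡ = fromIso (L.sym-iso L.identityˡ-iso)
      ; identityʳ = fromIso (L.sym-iso L.identityʳ-iso)
      ; assoc = λ {_} {_} {_} {_} {r} {s} {t} →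
          fromIso (L.sym-iso (L.assoc-iso {b = toCospan r} {toCospan s} {toCospan t})) }

  open SpanLemmas public using (SpanCat)

module _ {C : Category o ℓ e} (pushouts : HasPushouts C) (pullbacks : HasPullbacks C)
         {ε μ : Level} (FS : FactorisationSystem C ε μ)
         (costable : PushoutStable (FactorisationSystem.M FS))
         {α : Level} (A : WideSubcategory C α) (stable : PullbackStable A)
         (comp∈M : InducedIn pushouts pullbacks A (FactorisationSystem.M FS)) where
  open Category C
  open CatLemmas C
  open CospanLemmas C pushouts
  open CorelLemmas FS pushouts costable
  open SpanLemmas A pullbacks stable using (_⨾S_; idSpan; pb)

  private
    sp : ∀ {X Y} (s : Span A X Y) → Pushout C (Span.left s) (Span.right s)
    sp s = pushouts (Span.left s) (Span.right s)

  pushoutCospan : ∀ {X Y} → Span A X Y → Cospan C X Y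
  pushoutCospan s = cospan (Pushout.i (sp s)) (Pushout.j (sp s))

  private
    Π-cong : ∀ {X Y} {s t : Span A X Y} → SpanIso A s t →
             CospanIso C (pushoutCospan s) (pushoutCospan t)
    Π-cong {s = s} {t} f = record
      { φ = fw
      ; φ-iso = record
        { inv = bw
        ; isoˡ = PS.unique
            (≈.trans (pull PS.i-universal) (≈.trans PT.i-universal (≈.sym identityʳ)))
            (≈.trans (pull PS.j-universal) (≈.trans PT.j-universal (≈.sym identityʳ)))
        ; isoʳ = PT.unique
            (≈.trans (pull PT.i-universal) (≈.trans PS.i-universal (≈.sym identityʳ)))
            (≈.trans (pull PT.j-universal) (≈.trans PS.j-universal (≈.sym identityʳ))) }
      ; φ-left = PS.i-universal
      ; φ-right = PS.j-universal }
      where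
        open SpanIso f
        open Iso φ-iso
        module PS = Pushout (sp s)
        module PT = Pushout (sp t)
        inv-leg : ∀ {Z} {x : Span.apex t ⇒ Z} {y : Span.apex s ⇒ Z} → φ ⨾ x ≈ y → inv ⨾ y ≈ x
        inv-leg p = ≈.trans (rhs (≈.sym p)) (≈.trans (pull isoʳ) identityˡ)
        fw : PS.Q ⇒ PT.Q
        fw = PS.universal {h = PT.i} {k = PT.j}
          (≈.trans (lhs (≈.sym φ-left)) (≈.trans (push PT.commute) (pull φ-right)))
        bw : PT.Q ⇒ PS.Q
        bw = PT.universal {h = PS.i} {k = PS.j}
          (≈.trans (lhs (≈.sym (inv-leg φ-left)))
            (≈.trans (push PS.commute) (pull (inv-leg φ-right))))

    Π-id : ∀ {X} → CospanIso C (pushoutCospan (idSpan {X})) idCospan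
    Π-id {X} = record
      { φ = φ
      ; φ-iso = record
        { inv = P.i
        ; isoˡ = P.unique
            (≈.trans (pull P.i-universal) (≈.sym idComm))
            (≈.trans (pull P.j-universal)
              (≈.trans P.commute (≈.trans identityˡ (≈.sym identityʳ))))
        ; isoʳ = P.i-universal }
      ; φ-left = P.i-universal
      ; φ-right = P.j-universal }
      where
        module P = Pushout (sp (idSpan {X}))
        φ : P.Q ⇒ X
        φ = P.universal {h = id} {k = id} ≈.refl

    Π-⨾ : ∀ {X Y Z} (s : Span A X Y) (t : Span A Y Z) →
          CorelStep FS (pushoutCospan (s ⨾S t)) (pushoutCospan s ⨾C pushoutCospan t)
    Π-⨾ s t = record
      { m = m
      ; m∈M = costable
          (comparison {t = k} K.isPushout L.isPushout U.isPushout V.isPushout R.isPushout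
            K.i-universal K.j-universal K.i-universal K.j-universal
            L.i-universal L.j-universal)
          (comp∈M (Span.right s) (Span.left t) (Span.right∈ s) (Span.left∈ t))
      ; m-left = L.i-universal
      ; m-right = L.j-universal }
      where
        module W = Pullback (pb s t)
        module K = Pushout (pushouts W.p W.q)
        module L = Pushout (sp (s ⨾S t))
        module U = Pushout (sp s)
        module V = Pushout (sp t)
        module R = Pushout (po (pushoutCospan s) (pushoutCospan t))
        k : K.Q ⇒ L.Q
        k = K.universal {h = Span.left s ⨾ L.i} {k = Span.right t ⨾ L.j}
          (≈.trans (≈.sym assoc) (≈.trans L.commute assoc))
        m : L.Q ⇒ R.Q
        m = L.universal {h = U.i ⨾ R.i} {k = V.j ⨾ R.j} (begin
          (W.p ⨾ Span.left s) ⨾ U.i ⨾ R.i   ≈⟨ push (pull₂ U.commute) ⟩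
          W.p ⨾ Span.right s ⨾ U.j ⨾ R.i    ≈⟨ pull₂ W.commute ⟩
          W.q ⨾ Span.left t ⨾ U.j ⨾ R.i     ≈⟨ rhs (rhs R.commute) ⟩
          W.q ⨾ Span.left t ⨾ V.i ⨾ R.j     ≈⟨ rhs (pull₂ V.commute) ⟩
          W.q ⨾ Span.right t ⨾ V.j ⨾ R.j    ≈⟨ assoc ⟨
          (W.q ⨾ Span.right t) ⨾ V.j ⨾ R.j  ∎)

  Π : Functor (SpanCat A pullbacks stable) (Corel pushouts FS costable)
  Π = record
    { F₀ = λ X → X
    ; F₁ = pushoutCospan
    ; isFunctor = record
      { F-cong = λ f → iso⇒∼ (Π-cong f)
      ; F-id = iso⇒∼ Π-id
      ; F-⨾ = λ s t → Eq.return (Π-⨾ s t) } }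

-- The category A +_{|A|} Aᵒᵖ.  Its morphisms are all finite zigzags, with
-- equality generated by composing consecutive arrows of the same
-- direction and removing identities.  Reduced words are not used as
-- normal forms, because reducing needs a decision whether a morphism is
-- an identity; zigzag-isPushout shows that this quotient is the pushout
-- of A and Aᵒᵖ over the discrete category on the objects.
module _ (A : Category o ℓ e) where
  open Category A

  data Arrow (X Y : Obj) : Set ℓ where
    forward  : X ⇒ Y → Arrow X Y
    backward : Y ⇒ X → Arrow X Y

  Zigzag : Obj → Obj → Set (o ⊔ ℓ)
  Zigzag = Star Arrow

  infix 4 _⟶_
  data _⟶_ : ∀ {X Y} → Zigzag X Y → Zigzag X Y → Set (o ⊔ ℓ ⊔ e) where
    cong-forward  : ∀ {X Y Z} {f f′ : X ⇒ Y} {w : Zigzag Y Z} → f ≈ f′ →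
                    forward f ◅ w ⟶ forward f′ ◅ w
    cong-backward : ∀ {X Y Z} {f f′ : Y ⇒ X} {w : Zigzag Y Z} → f ≈ f′ →
                    backward f ◅ w ⟶ backward f′ ◅ w
    id-forward    : ∀ {X Y} {w : Zigzag X Y} → forward id ◅ w ⟶ w
    id-backward   : ∀ {X Y} {w : Zigzag X Y} → backward id ◅ w ⟶ w
    ⨾-forward     : ∀ {W X Y Z} {f : W ⇒ X} {g : X ⇒ Y} {w : Zigzag Y Z} →
                    forward f ◅ forward g ◅ w ⟶ forward (f ⨾ g) ◅ w
    ⨾-backward    : ∀ {W X Y Z} {f : X ⇒ W} {g : Y ⇒ X} {w : Zigzag Y Z} →
                    backward f ◅ backward g ◅ w ⟶ backward (g ⨾ f) ◅ w
    tail          : ∀ {X Y Z} (a : Arrow X Y) {w w′ : Zigzag Y Z} →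
                    w ⟶ w′ → a ◅ w ⟶ a ◅ w′

  private
    ⟶-◅◅ : ∀ {X Y Z} {w w′ : Zigzag X Y} (v : Zigzag Y Z) → w ⟶ w′ → w ◅◅ v ⟶ w′ ◅◅ v
    ⟶-◅◅ v (cong-forward p)  = cong-forward p
    ⟶-◅◅ v (cong-backward p) = cong-backward p
    ⟶-◅◅ v id-forward        = id-forward
    ⟶-◅◅ v id-backward       = id-backward
    ⟶-◅◅ v ⨾-forward         = ⨾-forward
    ⟶-◅◅ v ⨾-backward        = ⨾-backward
    ⟶-◅◅ v (tail a s)        = tail a (⟶-◅◅ v s)

    ◅◅-⟶ : ∀ {X Y Z} (v : Zigzag X Y) {w w′ : Zigzag Y Z} → w ⟶ w′ → v ◅◅ w ⟶ v ◅◅ w′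
    ◅◅-⟶ ε       s = s
    ◅◅-⟶ (a ◅ v) s = tail a (◅◅-⟶ v s)

  ZigzagCat : Category o (o ⊔ ℓ) (o ⊔ ℓ ⊔ e)
  ZigzagCat = record
    { Obj = Obj
    ; _⇒_ = Zigzag
    ; _≈_ = EqClosure _⟶_
    ; id = ε
    ; _⨾_ = _◅◅_
    ; equiv = Eq.isEquivalence _⟶_
    ; ⨾-cong = λ {_} {_} {_} {_} {w′} {v} p q →
        Eq.gmap (_◅◅ v) (⟶-◅◅ v) p ◅◅ Eq.gmap (w′ ◅◅_) (◅◅-⟶ w′) q
    ; identityˡ = ε
    ; identityʳ = λ {_} {_} {w} → ≡⇒≈ (◅◅-identityʳ w)
    ; assoc = λ {_} {_} {_} {_} {u} {v} {w} → ≡⇒≈ (◅◅-assoc u v w) }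
    where
      ≡⇒≈ : ∀ {X Y} {v w : Zigzag X Y} → v ≡ w → EqClosure _⟶_ v w
      ≡⇒≈ refl = ε
      ◅◅-identityʳ : ∀ {X Y} (w : Zigzag X Y) → w ◅◅ ε ≡ w
      ◅◅-identityʳ ε       = refl
      ◅◅-identityʳ (a ◅ w) = cong (a ◅_) (◅◅-identityʳ w)

-- The extension to zigzags of a functor on A and a functor on Aᵒᵖ with
-- the same object map.
module _ {A : Category o₁ ℓ₁ e₁} {D : Category o₂ ℓ₂ e₂}
         {F₀ : Category.Obj A → Category.Obj D}
         {F₁ : ∀ {X Y} → Category._⇒_ A X Y → Category._⇒_ D (F₀ X) (F₀ Y)}
         {G₁ : ∀ {X Y} → Category._⇒_ A X Y → Category._⇒_ D (F₀ Y) (F₀ X)}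
         (F : IsFunctor A D F₀ F₁) (G : IsFunctor (op A) D F₀ G₁) where
  private
    module A = Category A
    module F = IsFunctor F
    module G = IsFunctor G
  open Category D
  open CatLemmas D

  extendArrow : ∀ {X Y} → Arrow A X Y → F₀ X ⇒ F₀ Y
  extendArrow (forward f)  = F₁ f
  extendArrow (backward g) = G₁ g

  extend₁ : ∀ {X Y} → Zigzag A X Y → F₀ X ⇒ F₀ Y
  extend₁ ε       = id
  extend₁ (a ◅ w) = extendArrow a ⨾ extend₁ w

  private
    extend-⟶ : ∀ {X Y} {v w : Zigzag A X Y} → _⟶_ A v w → extend₁ v ≈ extend₁ w
    extend-⟶ (cong-forward p)  = lhs (F.F-cong p)
    extend-⟶ (cong-backward p) = lhs (G.F-cong p)
    extend-⟶ id-forward        = ≈.trans (lhs F.F-id) identityˡ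
    extend-⟶ id-backward       = ≈.trans (lhs G.F-id) identityˡ
    extend-⟶ ⨾-forward         = pull (≈.sym (F.F-⨾ _ _))
    extend-⟶ ⨾-backward        = pull (≈.sym (G.F-⨾ _ _))
    extend-⟶ (tail a s)        = rhs (extend-⟶ s)

    extend-⨾ : ∀ {X Y Z} (v : Zigzag A X Y) (w : Zigzag A Y Z) →
               extend₁ (v ◅◅ w) ≈ extend₁ v ⨾ extend₁ w
    extend-⨾ ε       w = ≈.sym identityˡ
    extend-⨾ (a ◅ v) w = ≈.trans (rhs (extend-⨾ v w)) (≈.sym assoc)

  extend : Functor (ZigzagCat A) D
  extend = record
    { F₀ = F₀
    ; F₁ = extend₁
    ; isFunctor = record
      { F-cong = Eq.gfold equiv extend₁ extend-⟶
      ; F-id = ≈.refl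
      ; F-⨾ = extend-⨾ } }

module _ {C : Category o ℓ e} (pushouts : HasPushouts C)
         {α : Level} (A : WideSubcategory C α) where
  open Category C
  open CatLemmas C
  open CospanLemmas C pushouts
  private
    module A = WideSubcategory A

    forwardCospan : ∀ {X Y} → X ⇒ Y → Cospan C X Y
    forwardCospan f = cospan f id

    backwardCospan : ∀ {X Y} → Y ⇒ X → Cospan C X Y
    backwardCospan g = cospan id g

    by-id : ∀ {X Y N} {f f′ : X ⇒ N} {g g′ : Y ⇒ N} → f ≈ f′ → g ≈ g′ →
            CospanIso C (cospan f g) (cospan f′ g′)
    by-id p q = record
      { φ = id ; φ-iso = iso-id
      ; φ-left = ≈.trans identityʳ p ; φ-right = ≈.trans identityʳ q }

    forward-⨾ : ∀ {X Y Z} (f : X ⇒ Y) (g : Y ⇒ Z) →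
                CospanIso C (forwardCospan (f ⨾ g)) (forwardCospan f ⨾C forwardCospan g)
    forward-⨾ f g = record
      { φ = P.j
      ; φ-iso = record
        { inv = ψ
        ; isoˡ = P.j-universal
        ; isoʳ = P.unique
            (≈.trans (pull P.i-universal) (≈.trans (≈.sym P.commute)
              (≈.trans identityˡ (≈.sym identityʳ))))
            (≈.trans (pull P.j-universal) (≈.sym idComm)) }
      ; φ-left = push (≈.trans (≈.sym P.commute) identityˡ)
      ; φ-right = ≈.refl }
      where
        module P = Pushout (po (forwardCospan f) (forwardCospan g))
        ψ : P.Q ⇒ _
        ψ = P.universal {h = g} {k = id} (≈.sym idComm)

    backward-⨾ : ∀ {X Y Z} (g : Y ⇒ X) (f : Z ⇒ Y) →
                 CospanIso C (backwardCospan (f ⨾ g)) (backwardCospan g ⨾C backwardCospan f)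
    backward-⨾ g f = record
      { φ = P.i
      ; φ-iso = record
        { inv = ψ
        ; isoˡ = P.i-universal
        ; isoʳ = P.unique
            (≈.trans (pull P.i-universal) (≈.sym idComm))
            (≈.trans (pull P.j-universal) (≈.trans P.commute
              (≈.trans identityˡ (≈.sym identityʳ)))) }
      ; φ-left = ≈.refl
      ; φ-right = push (≈.trans P.commute identityˡ) }
      where
        module P = Pushout (po (backwardCospan g) (backwardCospan f))
        ψ : P.Q ⇒ _
        ψ = P.universal {h = id} {k = g} idComm

  zigzagToCospan : Functor (ZigzagCat A.category) (CospanCat C pushouts)
  zigzagToCospan = extend {F₀ = λ X → X}
    {F₁ = λ f → forwardCospan (proj₁ f)} {G₁ = λ g → backwardCospan (proj₁ g)}
    record { F-cong = λ p → by-id p ≈.refl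
           ; F-id = by-id ≈.refl ≈.refl
           ; F-⨾ = λ f g → forward-⨾ (proj₁ f) (proj₁ g) }
    record { F-cong = λ p → by-id ≈.refl p
           ; F-id = by-id ≈.refl ≈.refl
           ; F-⨾ = λ g f → backward-⨾ (proj₁ g) (proj₁ f) }

module _ {C : Category o ℓ e} (pullbacks : HasPullbacks C)
         {α : Level} (A : WideSubcategory C α) (stable : PullbackStable A) where
  open Category C
  open CatLemmas C
  open SpanLemmas A pullbacks stable using (_⨾S_; pb)
  private
    module A = WideSubcategory A

    forwardSpan : ∀ {X Y} → Category._⇒_ A.category X Y → Span A X Y
    forwardSpan (f , f∈A) = span A.mem-id f∈A

    backwardSpan : ∀ {X Y} → Category._⇒_ A.category Y X → Span A X Y
    backwardSpan (g , g∈A) = span g∈A A.mem-id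

    by-id : ∀ {X Y} {s t : Span A X Y} (φ : Span.apex s ⇒ Span.apex t) → Iso φ →
            φ ⨾ Span.left t ≈ Span.left s → φ ⨾ Span.right t ≈ Span.right s → SpanIso A s t
    by-id φ φ-iso p q = record { φ = φ ; φ-iso = φ-iso ; φ-left = p ; φ-right = q }

    forward-⨾ : ∀ {X Y Z} (f : Category._⇒_ A.category X Y) (g : Category._⇒_ A.category Y Z) →
                SpanIso A (forwardSpan (Category._⨾_ A.category f g))
                          (forwardSpan f ⨾S forwardSpan g)
    forward-⨾ f g = record
      { φ = ψ
      ; φ-iso = record
        { inv = P.p
        ; isoˡ = P.universal-p
        ; isoʳ = P.unique
            (≈.trans (push P.universal-p) idComm)
            (≈.trans (push P.universal-q) (≈.trans P.commute
              (≈.trans identityʳ (≈.sym identityˡ)))) }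
      ; φ-left = ≈.trans (pull P.universal-p) identityˡ
      ; φ-right = pull P.universal-q }
      where
        module P = Pullback (pb (forwardSpan f) (forwardSpan g))
        ψ : _ ⇒ P.P
        ψ = P.universal {h = id} {k = proj₁ f} (≈.sym idComm)

    backward-⨾ : ∀ {X Y Z} (g : Category._⇒_ A.category Y X) (f : Category._⇒_ A.category Z Y) →
                 SpanIso A (backwardSpan (Category._⨾_ A.category f g))
                           (backwardSpan g ⨾S backwardSpan f)
    backward-⨾ g f = record
      { φ = ψ
      ; φ-iso = record
        { inv = P.q
        ; isoˡ = P.universal-q
        ; isoʳ = P.unique
            (≈.trans (push P.universal-p) (≈.trans (≈.sym P.commute)
              (≈.trans identityʳ (≈.sym identityˡ))))
            (≈.trans (push P.universal-q) idComm) }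
      ; φ-left = pull P.universal-p
      ; φ-right = ≈.trans (pull P.universal-q) identityˡ }
      where
        module P = Pullback (pb (backwardSpan g) (backwardSpan f))
        ψ : _ ⇒ P.P
        ψ = P.universal {h = proj₁ f} {k = id} idComm

  zigzagToSpan : Functor (ZigzagCat A.category) (SpanCat A pullbacks stable)
  zigzagToSpan = extend {F₀ = λ X → X} {F₁ = forwardSpan} {G₁ = backwardSpan}
    record { F-cong = λ p → by-id id iso-id identityˡ (≈.trans identityˡ (≈.sym p))
           ; F-id = by-id id iso-id identityˡ identityˡ
           ; F-⨾ = forward-⨾ }
    record { F-cong = λ p → by-id id iso-id (≈.trans identityˡ (≈.sym p)) identityˡ
           ; F-id = by-id id iso-id identityˡ identityˡ
           ; F-⨾ = backward-⨾ }

module _ (A : Category o ℓ e) where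
  private module A = Category A
  Discrete : Category o o o
  Discrete = record
    { Obj = A.Obj ; _⇒_ = _≡_ ; _≈_ = _≡_ ; id = refl ; _⨾_ = trans
    ; equiv = isEquivalence ; ⨾-cong = cong₂ trans
    ; identityˡ = refl ; identityʳ = λ { {f = p} → trans-reflʳ p }
    ; assoc = λ { {f = p} → trans-assoc p } }

  fromDiscrete : {B : Category o₂ ℓ₂ e₂} → (A.Obj → Category.Obj B) → Functor Discrete B
  fromDiscrete {B = B} F₀ = record
    { F₀ = F₀ ; F₁ = λ { refl → B.id }
    ; isFunctor = record
      { F-cong = λ { refl → B.≈.refl } ; F-id = B.≈.refl
      ; F-⨾ = λ { refl refl → B.≈.sym B.identityˡ } } }
    where module B = Category B

  inclForward : Functor A (ZigzagCat A)
  inclForward = record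
    { F₀ = λ X → X ; F₁ = λ f → forward f ◅ ε
    ; isFunctor = record
      { F-cong = λ p → Eq.return (cong-forward p) ; F-id = Eq.return id-forward
      ; F-⨾ = λ f g → Eq.symmetric (_⟶_ A) (Eq.return ⨾-forward) } }

  inclBackward : Functor (op A) (ZigzagCat A)
  inclBackward = record
    { F₀ = λ X → X ; F₁ = λ f → backward f ◅ ε
    ; isFunctor = record
      { F-cong = λ p → Eq.return (cong-backward p) ; F-id = Eq.return id-backward
      ; F-⨾ = λ f g → Eq.symmetric (_⟶_ A) (Eq.return ⨾-backward) } }

module _ (D : Category o ℓ e) where
  open Category D
  subst₂-id : ∀ {X Y} (p : X ≡ Y) → subst₂ _⇒_ p p id ≈ id
  subst₂-id refl = ≈.refl
  subst₂-⨾ : ∀ {X Y Z X′ Y′ Z′} (p : X ≡ X′) (q : Y ≡ Y′) (r : Z ≡ Z′) (f : X ⇒ Y) (g : Y ⇒ Z) →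
             subst₂ _⇒_ p r (f ⨾ g) ≈ subst₂ _⇒_ p q f ⨾ subst₂ _⇒_ q r g
  subst₂-⨾ refl refl refl f g = ≈.refl
  subst₂-cong : ∀ {X Y X′ Y′} (p : X ≡ X′) (q : Y ≡ Y′) {f g : X ⇒ Y} → f ≈ g →
             subst₂ _⇒_ p q f ≈ subst₂ _⇒_ p q g
  subst₂-cong refl refl e = e
  subst₂-sym : ∀ {X Y X′ Y′} (p p′ : X ≡ X′) (q q′ : Y ≡ Y′) (f : X′ ⇒ Y′) →
             subst₂ _⇒_ p q (subst₂ _⇒_ (sym p′) (sym q′) f) ≈ f
  subst₂-sym refl refl refl refl f = ≈.refl
  subst₂-K : ∀ {X Y X′ Y′ X″ Y″} (a : X ≡ X′) (a′ : Y ≡ Y′) (b : X ≡ X″) (b′ : Y ≡ Y″)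
             (c : X′ ≡ X″) (c′ : Y′ ≡ Y″)(f : X ⇒ Y) →
             subst₂ _⇒_ a a′ f ≈ subst₂ _⇒_ (sym c) (sym c′) (subst₂ _⇒_ b b′ f)
  subst₂-K refl refl refl refl refl refl f = ≈.refl

zigzag-isPushout : (A : Category o ℓ e) →
  IsPushoutInCAT (fromDiscrete A {B = A} λ X → X) (fromDiscrete A {B = op A} λ X → X)
                 (inclForward A) (inclBackward A) o₃ ℓ₃ e₃
zigzag-isPushout {o₃ = o₃} {ℓ₃} {e₃} A = record
  { commute = record { eq₀ = λ _ → refl
                     ; eq₁ = λ { refl → Eq.return id-forward ◅◅ Eq.symmetric (_⟶_ A) (Eq.return id-backward) } }
  ; universal = univ }
  where
  univ : (X : Category o₃ ℓ₃ e₃) (P : Functor A X) (Q : Functor (op A) X) →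
         fromDiscrete A (λ X → X) ⨾F P ≡F fromDiscrete A (λ X → X) ⨾F Q →
         Σ[ U ∈ Functor (ZigzagCat A) X ] (inclForward A ⨾F U ≡F P) × (inclBackward A ⨾F U ≡F Q) ×
           (∀ V → inclForward A ⨾F V ≡F P → inclBackward A ⨾F V ≡F Q → V ≡F U)
  univ X P Q eq = U , record { eq₀ = λ _ → refl ; eq₁ = λ f → X.identityʳ }
    , record { eq₀ = eq₀ ; eq₁ = λ {a} {b} f →
         X.≈.trans (subst₂-cong X (eq₀ a) (eq₀ b) X.identityʳ) (subst₂-sym X (eq₀ a) (eq₀ a) (eq₀ b) (eq₀ b) _) }
    , uniq
    where
    module X = Category X
    module P = Functor P
    module Q = Functor Q
    open _≡F_ eq
    QF : IsFunctor (op A) X P.F₀ (λ {a} {b} f → subst₂ X._⇒_ (sym (eq₀ a)) (sym (eq₀ b)) (Q.F₁ f))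
    QF = record
      { F-cong = λ {a} {b} p → subst₂-cong X (sym (eq₀ a)) (sym (eq₀ b)) (Q.F-cong p)
      ; F-id = λ {a} → X.≈.trans (subst₂-cong X (sym (eq₀ a)) (sym (eq₀ a)) Q.F-id) (subst₂-id X (sym (eq₀ a)))
      ; F-⨾ = λ {a} {b} {c} f g → X.≈.trans (subst₂-cong X (sym (eq₀ a)) (sym (eq₀ c)) (Q.F-⨾ f g))
                  (subst₂-⨾ X (sym (eq₀ a)) (sym (eq₀ b)) (sym (eq₀ c)) _ _) }
    U : Functor (ZigzagCat A) X
    U = extend P.isFunctor QF
    uniq : (V : Functor (ZigzagCat A) X) → inclForward A ⨾F V ≡F P → inclBackward A ⨾F V ≡F Q → V ≡F U
    uniq V a b = record { eq₀ = a.eq₀ ; eq₁ = go }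
      where
      module a = _≡F_ a
      module b = _≡F_ b
      module V = Functor V
      module U = Functor U
      arr : ∀ {x y} (s : Arrow A x y) →
            subst₂ X._⇒_ (a.eq₀ x) (a.eq₀ y) (V.F₁ (s ◅ ε)) X.≈ extendArrow P.isFunctor QF s
      arr (forward f) = a.eq₁ f
      arr {x} {y} (backward g) = X.≈.trans (subst₂-K X (a.eq₀ x) (a.eq₀ y) (b.eq₀ x) (b.eq₀ y) (eq₀ x) (eq₀ y) _)
           (subst₂-cong X (sym (eq₀ x)) (sym (eq₀ y)) (b.eq₁ g))
      go : ∀ {x y} (w : Zigzag A x y) → subst₂ X._⇒_ (a.eq₀ x) (a.eq₀ y) (V.F₁ w) X.≈ U.F₁ w
      go {x} ε = X.≈.trans (subst₂-cong X (a.eq₀ x) (a.eq₀ x) V.F-id) (subst₂-id X (a.eq₀ x))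
      go {x} {y} (_◅_ {j = z} s w) =
        X.≈.trans (subst₂-cong X (a.eq₀ x) (a.eq₀ y) (V.F-⨾ (s ◅ ε) w))
        (X.≈.trans (subst₂-⨾ X (a.eq₀ x) (a.eq₀ z) (a.eq₀ y) _ _)
          (X.⨾-cong (arr s) (go w)))

{-# OPTIONS --safe #-}
module Submission where

-- A functor on corelations is a functor Q on cospans that is invariant under
-- (f , g) ↦ (f ⨾ m , g ⨾ m) for m ∈ M.  The cospan (f ⨾ m , g ⨾ m) is
-- (f , id) ⨾ (m , m) ⨾ (id , g), and (m , m) is the image of the zigzag m ⨾ m⁻¹,
-- whose span is the kernel pair of the monomorphism m, i.e. the identity.  So if
-- Q agrees on zigzags with a functor P on spans, then Q sends (m , m) to an
-- identity.  The induced functor extends P because a span (l , r) is the image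
-- of the zigzag l⁻¹ ⨾ r, whose cospan is the pushout of (l , r).

open import Level using (Level)
open import Data.Product using (_,_)
open import Relation.Binary.PropositionalEquality using (_≡_; refl; sym; subst₂)
open import Relation.Binary.Construct.Closure.ReflexiveTransitive using (ε; _◅_)
import Relation.Binary.Construct.Closure.Equivalence as Eq
open import Defs

private
  variable
    o ℓ e o′ ℓ′ e′ κ : Level

-- Equality of functors out of a zigzag category.

module _ {A : Category o ℓ e} {D : Category o′ ℓ′ e′} where
  open Category D

  -- Single arrows generate all zigzags under concatenation, so agreement spreads by induction on
  -- the length, with transport distributing over composition.
  zigzag-ext : (F G : Functor (ZigzagCat A) D) (eq₀ : ∀ X → Functor.F₀ F X ≡ Functor.F₀ G X) →
    (∀ {X Y} (a : Arrow A X Y) →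
      subst₂ _⇒_ (eq₀ X) (eq₀ Y) (Functor.F₁ F (a ◅ ε)) ≈ Functor.F₁ G (a ◅ ε)) →
    F ≡F G
  zigzag-ext F G eq₀ arrows = record { eq₀ = eq₀ ; eq₁ = zigzags }
    where
    module F = Functor F
    module G = Functor G
    zigzags : ∀ {X Y} (w : Zigzag A X Y) → subst₂ _⇒_ (eq₀ X) (eq₀ Y) (F.F₁ w) ≈ G.F₁ w
    zigzags {X} ε =
      ≈.trans (subst₂-cong D (eq₀ X) (eq₀ X) F.F-id)
        (≈.trans (subst₂-id D (eq₀ X)) (≈.sym G.F-id))
    zigzags {X} {Z} (_◅_ {j = Y} a w) =
      ≈.trans (subst₂-cong D (eq₀ X) (eq₀ Z) (F.F-⨾ (a ◅ ε) w))
        (≈.trans (subst₂-⨾ D (eq₀ X) (eq₀ Y) (eq₀ Z) _ _)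
          (≈.trans (⨾-cong (arrows a) (zigzags w)) (≈.sym (G.F-⨾ (a ◅ ε) w))))

-- Pushout squares and isomorphisms of cospans.

module _ (C : Category o ℓ e) where
  open Category C
  open CatLemmas C

  subst₂-sym-subst₂ : ∀ {X Y X′ Y′} (p : X ≡ X′) (q : Y ≡ Y′) (f : X ⇒ Y) →
                      subst₂ _⇒_ (sym p) (sym q) (subst₂ _⇒_ p q f) ≈ f
  subst₂-sym-subst₂ refl refl f = ≈.refl

  id-mono : ∀ {X} → Mono (id {X})
  id-mono u v p = ≈.trans (≈.sym identityʳ) (≈.trans p identityʳ)

  -- A cocone `(h , k)` is determined by `k`, since its commutativity forces `h ≈ f ⨾ k`.
  IsPushout-id : ∀ {X Y} (f : X ⇒ Y) → IsPushout C id f f id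
  IsPushout-id f = record
    { commute = ≈.sym idComm
    ; universal = λ {_} {_} {k} _ → k
    ; i-universal = λ {_} {_} {_} {eq} → ≈.trans (≈.sym eq) identityˡ
    ; j-universal = identityˡ
    ; unique = λ _ q → ≈.trans (≈.sym identityˡ) (≈.trans q identityˡ) }

  IsPushout⇒CospanIso : ∀ {S X Y Q R} {f : S ⇒ X} {g : S ⇒ Y}
    {i : X ⇒ Q} {j : Y ⇒ Q} {i′ : X ⇒ R} {j′ : Y ⇒ R} →
    IsPushout C f g i j → IsPushout C f g i′ j′ →
    CospanIso C (cospan i j) (cospan i′ j′)
  IsPushout⇒CospanIso P P′ = record
    { φ = P.universal P′.commute
    ; φ-iso = record
      { inv = P′.universal P.commute
      ; isoˡ = P.unique
          (≈.trans (pull P.i-universal) (≈.trans P′.i-universal (≈.sym identityʳ)))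
          (≈.trans (pull P.j-universal) (≈.trans P′.j-universal (≈.sym identityʳ)))
      ; isoʳ = P′.unique
          (≈.trans (pull P′.i-universal) (≈.trans P.i-universal (≈.sym identityʳ)))
          (≈.trans (pull P′.j-universal) (≈.trans P.j-universal (≈.sym identityʳ))) }
    ; φ-left = P.i-universal
    ; φ-right = P.j-universal }
    where
      module P = IsPushout P
      module P′ = IsPushout P′

  CospanIso-precompose : ∀ {X Y X′ Y′} (f : X′ ⇒ X) (g : Y′ ⇒ Y) {c d : Cospan C X Y} →
    CospanIso C c d →
    CospanIso C (cospan (f ⨾ Cospan.left c) (g ⨾ Cospan.right c))
                (cospan (f ⨾ Cospan.left d) (g ⨾ Cospan.right d))
  CospanIso-precompose f g I = record
    { φ = φ ; φ-iso = φ-iso ; φ-left = push φ-left ; φ-right = push φ-right }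
    where open CospanIso I

-- Composites of cospans computed from convenient pushouts.

module _ (C : Category o ℓ e) (pushouts : HasPushouts C) where
  open Category C
  open CatLemmas C
  open CospanLemmas C pushouts

  ≈⇒CospanIso : ∀ {X Y N} {f f′ : X ⇒ N} {g g′ : Y ⇒ N} → f ≈ f′ → g ≈ g′ →
                CospanIso C (cospan f g) (cospan f′ g′)
  ≈⇒CospanIso p q = record
    { φ = id ; φ-iso = iso-id
    ; φ-left = ≈.trans identityʳ p ; φ-right = ≈.trans identityʳ q }

  -- `_⨾C_` uses the chosen pushout, and any other pushout of the same span is isomorphic to it
  -- under the outer legs.
  IsPushout⇒⨾C : ∀ {X Y Z Q} {c : Cospan C X Y} {d : Cospan C Y Z}
    {i : Cospan.apex c ⇒ Q} {j : Cospan.apex d ⇒ Q} →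
    IsPushout C (Cospan.right c) (Cospan.left d) i j →
    CospanIso C (c ⨾C d) (cospan (Cospan.left c ⨾ i) (Cospan.right d ⨾ j))
  IsPushout⇒⨾C {c = c} {d} P =
    CospanIso-precompose C (Cospan.left c) (Cospan.right d)
      (IsPushout⇒CospanIso C (Pushout.isPushout (po c d)) P)

  forward-⨾C : ∀ {X Y Z N} (f : X ⇒ Y) (u : Y ⇒ N) (v : Z ⇒ N) →
               CospanIso C (cospan f id ⨾C cospan u v) (cospan (f ⨾ u) v)
  forward-⨾C f u v =
    trans-iso (IsPushout⇒⨾C (IsPushout-id C u)) (≈⇒CospanIso ≈.refl identityʳ)

  ⨾C-backward : ∀ {X Y Z N} (u : X ⇒ N) (v : Y ⇒ N) (g : Z ⇒ Y) →
                CospanIso C (cospan u v ⨾C cospan id g) (cospan u (g ⨾ v))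
  ⨾C-backward u v g =
    trans-iso (IsPushout⇒⨾C (IsPushout-swap (IsPushout-id C v))) (≈⇒CospanIso identityʳ ≈.refl)

  -- Absorbing `g` on the right and then `f` on the left uses only pushouts along identities. The
  -- point is to isolate `cospan m m`.
  factor-cospan : ∀ {X Y N N′} (f : X ⇒ N) (g : Y ⇒ N) (m : N ⇒ N′) →
    CospanIso C (cospan (f ⨾ m) (g ⨾ m)) (cospan f id ⨾C (cospan m m ⨾C cospan id g))
  factor-cospan f g m = sym-iso
    (trans-iso (cong-iso {c = cospan f id} refl-iso (⨾C-backward m m g))
               (forward-⨾C f m (g ⨾ m)))

-- Kernel pairs of monomorphisms in composites of spans.

module _ {C : Category o ℓ e} (pullbacks : HasPullbacks C)
         (A : WideSubcategory C κ) (stable : PullbackStable A) where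
  open Category C
  open CatLemmas C
  open WideSubcategory A
  open SpanLemmas A pullbacks stable using (_⨾S_; pb)

  -- The two projections of the pullback of a monomorphism along itself agree, and the diagonal
  -- inverts them.
  cancel-mono : ∀ {X Y Z S} {l : S ⇒ X} {m : S ⇒ Y} {r : S ⇒ Z} →
    Mono m → (l∈ : mem l) (m∈ m∈′ : mem m) (r∈ : mem r) →
    SpanIso A (span l∈ m∈ ⨾S span m∈′ r∈) (span l∈ r∈)
  cancel-mono {S = S} {m = m} mono l∈ m∈ m∈′ r∈ = record
    { φ = W.p
    ; φ-iso = record
      { inv = diagonal
      ; isoˡ = W.unique
          (≈.trans (push W.universal-p) idComm)
          (≈.trans (push W.universal-q) (≈.trans identityʳ (≈.trans p≈q (≈.sym identityˡ))))
      ; isoʳ = W.universal-p }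
    ; φ-left = ≈.refl
    ; φ-right = lhs p≈q }
    where
      module W = Pullback (pb (span l∈ m∈) (span m∈′ r∈))
      p≈q : W.p ≈ W.q
      p≈q = mono W.p W.q W.commute
      diagonal : S ⇒ W.P
      diagonal = W.universal {h = id} {k = id} ≈.refl

theorem3p2 : {o ℓ e ε μ α o′ ℓ′ e′ : Level}
    (C : Category o ℓ e)
    (pushouts : HasPushouts C) (pullbacks : HasPullbacks C)
    (FS : FactorisationSystem C ε μ)
    (costable : PushoutStable (FactorisationSystem.M FS))
    (M-mono : AllMono (FactorisationSystem.M FS))
    (A : WideSubcategory C α)
    (M⊆A : FactorisationSystem.M FS ⊆ A)
    (stable : PullbackStable A)
    (comp∈M : InducedIn pushouts pullbacks A (FactorisationSystem.M FS)) →
    IsPushoutInCAT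
    (zigzagToSpan pullbacks A stable)
    (zigzagToCospan pushouts A)
    (Π pushouts pullbacks FS costable A stable comp∈M)
    (Γ pushouts FS costable)
    o′ ℓ′ e′

-- Commutativity of the square.

theorem3p2 C pushouts pullbacks FS costable M-mono A M⊆A stable comp∈M
  .IsPushoutInCAT.commute = zigzag-ext _ _ (λ _ → refl) arrowSquare
  where
    open Category C
    open CatLemmas C
    open CospanLemmas C pushouts
    open CorelLemmas FS pushouts costable
    module A = WideSubcategory A
    module Sp = Category (SpanCat A pullbacks stable)
    module Cr = Category (Corel pushouts FS costable)
    module ZS = Functor (zigzagToSpan pullbacks A stable)
    module ZC = Functor (zigzagToCospan pushouts A)
    module Π′ = Functor (Π pushouts pullbacks FS costable A stable comp∈M)

    -- A one-arrow zigzag is sent to the image of its arrow composed with an identity, which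
    -- `identityʳ` strips on both sides. What remains is a pushout along an identity.
    arrowSquare : ∀ {X Y} (a : Arrow A.category X Y) →
                  Π′.F₁ (ZS.F₁ (a ◅ ε)) Cr.≈ ZC.F₁ (a ◅ ε)
    arrowSquare (forward (f , f∈)) =
      Cr.≈.trans (Π′.F-cong (Sp.identityʳ {f = span A.mem-id f∈}))
        (iso⇒∼ (trans-iso
          (IsPushout⇒CospanIso C (Pushout.isPushout (pushouts id f)) (IsPushout-id C f))
          (sym-iso (identityʳ-iso {c = cospan f id}))))
    arrowSquare (backward (g , g∈)) =
      Cr.≈.trans (Π′.F-cong (Sp.identityʳ {f = span g∈ A.mem-id}))
        (iso⇒∼ (trans-iso
          (IsPushout⇒CospanIso C (Pushout.isPushout (pushouts g id))
                                 (IsPushout-swap (IsPushout-id C g)))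
          (sym-iso (identityʳ-iso {c = cospan id g}))))

-- The universal property.

theorem3p2 C pushouts pullbacks FS costable M-mono A M⊆A stable comp∈M
  .IsPushoutInCAT.universal X P Q eq =
    -- Corelations are cospans under a coarser equality, so the data of `Q` is kept and the new
    -- obligation is `F-cong`.
    record
      { F₀ = Q.F₀ ; F₁ = Q.F₁
      ; isFunctor = record { F-cong = Q-respects-∼ ; F-id = Q.F-id ; F-⨾ = Q.F-⨾ } }
  , record { eq₀ = λ Y → sym (eq₀ Y) ; eq₁ = Q-Π }
  , record { eq₀ = λ _ → refl ; eq₁ = λ _ → X.≈.refl }
  -- `Γ` leaves objects and representing cospans unchanged, so `ΓV≡Q` already compares `V` with the
  -- mediating functor.
  , λ V _ ΓV≡Q → record { eq₀ = _≡F_.eq₀ ΓV≡Q ; eq₁ = _≡F_.eq₁ ΓV≡Q }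
  where
    open Category C
    open CatLemmas C
    open CospanLemmas C pushouts
    module A = WideSubcategory A
    module M = FactorisationSystem.M FS
    module Sp = Category (SpanCat A pullbacks stable)
    module ZS = Functor (zigzagToSpan pullbacks A stable)
    module ZC = Functor (zigzagToCospan pushouts A)
    module Π′ = Functor (Π pushouts pullbacks FS costable A stable comp∈M)
    module X = Category X
    module P = Functor P
    module Q = Functor Q
    open _≡F_ eq

    spanZigzag : ∀ {X Y S} {l : S ⇒ X} {r : S ⇒ Y} → A.mem l → A.mem r → Zigzag A.category X Y
    spanZigzag l∈ r∈ = backward (_ , l∈) ◅ forward (_ , r∈) ◅ ε

    spanZigzag-toSpan : ∀ {X Y S} {l : S ⇒ X} {r : S ⇒ Y} (l∈ : A.mem l) (r∈ : A.mem r) →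
      ZS.F₁ (spanZigzag l∈ r∈) Sp.≈ span l∈ r∈
    spanZigzag-toSpan l∈ r∈ =
      Sp.≈.trans {j = Sp._⨾_ (span l∈ A.mem-id) (span A.mem-id r∈)}
        (Sp.⨾-cong {f = span l∈ A.mem-id} {f′ = span l∈ A.mem-id}
                   (Sp.≈.refl {x = span l∈ A.mem-id}) (Sp.identityʳ {f = span A.mem-id r∈}))
        (cancel-mono pullbacks A stable (id-mono C) l∈ A.mem-id A.mem-id r∈)

    -- Composing `cospan id l` with `cospan r id` pushes out `l` and `r`, which is how `Π` is
    -- defined.
    spanZigzag-toCospan : ∀ {X Y S} {l : S ⇒ X} {r : S ⇒ Y} (l∈ : A.mem l) (r∈ : A.mem r) →
      CospanIso C (ZC.F₁ (spanZigzag l∈ r∈)) (Π′.F₁ (span l∈ r∈))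
    spanZigzag-toCospan {l = l} {r} l∈ r∈ =
      trans-iso
        (cong-iso {c = cospan id l} {cospan id l} refl-iso (identityʳ-iso {c = cospan r id}))
        (trans-iso
          (IsPushout⇒⨾C C pushouts {c = cospan id l} {cospan r id}
                        (Pushout.isPushout (pushouts l r)))
          (≈⇒CospanIso C pushouts identityˡ identityˡ))

    kernelZigzag : ∀ {X Y} {m : X ⇒ Y} → A.mem m → Zigzag A.category X X
    kernelZigzag m∈ = forward (_ , m∈) ◅ backward (_ , m∈) ◅ ε

    -- The composite span is the kernel pair of `m`, which is trivial because `m` is a monomorphism.
    kernelZigzag-toSpan : ∀ {X Y} {m : X ⇒ Y} → Mono m → (m∈ : A.mem m) →
      ZS.F₁ (kernelZigzag m∈) Sp.≈ Sp.id
    kernelZigzag-toSpan mono m∈ =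
      Sp.≈.trans {j = Sp._⨾_ (span A.mem-id m∈) (span m∈ A.mem-id)}
        (Sp.⨾-cong {f = span A.mem-id m∈} {f′ = span A.mem-id m∈}
                   (Sp.≈.refl {x = span A.mem-id m∈}) (Sp.identityʳ {f = span m∈ A.mem-id}))
        (cancel-mono pullbacks A stable mono A.mem-id m∈ m∈ A.mem-id)

    kernelZigzag-toCospan : ∀ {X Y} {m : X ⇒ Y} (m∈ : A.mem m) →
      CospanIso C (ZC.F₁ (kernelZigzag m∈)) (cospan m m)
    kernelZigzag-toCospan {m = m} m∈ =
      trans-iso
        (cong-iso {c = cospan m id} {cospan m id} refl-iso (identityʳ-iso {c = cospan id m}))
        (trans-iso (forward-⨾C C pushouts m id m) (≈⇒CospanIso C pushouts identityʳ ≈.refl))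

    -- This is how `eq` gets used: a zigzag `w` links its span and its cospan, each replaceable by
    -- an isomorphic one.
    transported : ∀ {Y Z} (w : Zigzag A.category Y Z) {s : Span A Y Z} {c : Cospan C Y Z} →
      SpanIso A (ZS.F₁ w) s → CospanIso C (ZC.F₁ w) c →
      subst₂ X._⇒_ (eq₀ Y) (eq₀ Z) (P.F₁ s) X.≈ Q.F₁ c
    transported {Y} {Z} w {s} p q =
      X.≈.trans (subst₂-cong X (eq₀ Y) (eq₀ Z) (X.≈.sym (P.F-cong p)))
        (X.≈.trans (eq₁ w) (Q.F-cong q))

    Q-M : ∀ {N N′} (m : N ⇒ N′) → M.mem m → Q.F₁ (cospan m m) X.≈ X.id
    Q-M {N} m m∈M =
      X.≈.trans
        (X.≈.sym (transported (kernelZigzag m∈A)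
          (kernelZigzag-toSpan (M-mono m m∈M) m∈A) (kernelZigzag-toCospan m∈A)))
        -- Both ends are transported along the same `eq₀ N`, so the identity stays an identity.
        (X.≈.trans (subst₂-cong X (eq₀ N) (eq₀ N) P.F-id) (subst₂-id X (eq₀ N)))
      where
        m∈A : A.mem m
        m∈A = M⊆A m m∈M

    Q-forward-backward : ∀ {Y Z N} (f : Y ⇒ N) (g : Z ⇒ N) →
      Q.F₁ (cospan f id) X.⨾ Q.F₁ (cospan id g) X.≈ Q.F₁ (cospan f g)
    Q-forward-backward f g =
      X.≈.trans (X.≈.sym (Q.F-⨾ (cospan f id) (cospan id g)))
        (Q.F-cong (trans-iso (forward-⨾C C pushouts f id g)
                             (≈⇒CospanIso C pushouts identityʳ ≈.refl)))

    -- Under `Q` the middle factor of `factor-cospan` becomes an identity, and the outer two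
    -- recompose to `cospan f g`.
    Q-cancel-M : ∀ {Y Z N N′} (f : Y ⇒ N) (g : Z ⇒ N) (m : N ⇒ N′) → M.mem m →
      Q.F₁ (cospan (f ⨾ m) (g ⨾ m)) X.≈ Q.F₁ (cospan f g)
    Q-cancel-M f g m m∈M =
      X.≈.trans (Q.F-cong (factor-cospan C pushouts f g m))
        (X.≈.trans (Q.F-⨾ (cospan f id) (cospan m m ⨾C cospan id g))
          (X.≈.trans
            (X.⨾-cong X.≈.refl
              (X.≈.trans (Q.F-⨾ (cospan m m) (cospan id g))
                (X.≈.trans (X.⨾-cong (Q-M m m∈M) X.≈.refl) X.identityˡ)))
            (Q-forward-backward f g)))

    Q-step : ∀ {Y Z} {c d : Cospan C Y Z} → CorelStep FS c d → Q.F₁ c X.≈ Q.F₁ d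
    Q-step {c = c} s =
      X.≈.trans (X.≈.sym (Q-cancel-M (Cospan.left c) (Cospan.right c) m m∈M))
        (Q.F-cong (≈⇒CospanIso C pushouts m-left m-right))
      where open CorelStep s

    Q-respects-∼ : ∀ {Y Z} {c d : Cospan C Y Z} → _∼_ FS c d → Q.F₁ c X.≈ Q.F₁ d
    Q-respects-∼ = Eq.gfold X.equiv Q.F₁ Q-step

    -- The mediating functor has the object map of `Q`, so `transported` at `spanZigzag` is read
    -- backwards and its transport undone.
    Q-Π : ∀ {Y Z} (s : Span A Y Z) →
      subst₂ X._⇒_ (sym (eq₀ Y)) (sym (eq₀ Z)) (Q.F₁ (Π′.F₁ s)) X.≈ P.F₁ s
    Q-Π {Y} {Z} s@(span l∈ r∈) =
      X.≈.trans
        (subst₂-cong X (sym (eq₀ Y)) (sym (eq₀ Z))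
          (X.≈.sym (transported (spanZigzag l∈ r∈)
            (spanZigzag-toSpan l∈ r∈) (spanZigzag-toCospan l∈ r∈))))
        (subst₂-sym-subst₂ X (eq₀ Y) (eq₀ Z) (P.F₁ s))
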